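{- Let $\varepsilon>0$, let $r\geq 2$ be an integer, and let $C=\frac{80}{\varepsilon}\log\frac1\varepsilon$. Then there is a constant $\alpha>0$ such that for all sufficiently large $n$, every locally $\varepsilon$-balanced $r$-edge-colouring of an $n$-vertex graph $G$ contains a homogeneous $\alpha\log n$-blow-up of some unibalanced $r$-edge-coloured graph $H$ on at most $C$ vertices.
   Context: An $r$-edge-colouring of an $n$-vertex graph is locally $\varepsilon$-balanced if every vertex is incident to at least $\varepsilon n$ edges of each of the $r$ colours. An $r$-edge-coloured graph $H$ is unibalanced if every vertex of $H$ is incident to at least one edge of each of the $r$ colours. For $V(H)=\{1,\dots,k\}$, $G$ contains a homogeneous $t$-blow-up of $H$ if there are disjoint sets $V_1,\dots,V_k\subseteq V(G)$ of size (at least) $t$ such that each $V_i$ induces a complete graph in $G$ all of whose edges have the same colour (which may depend on $i$), and for every edge $ij$ of $H$ of colour $c$, every pair $\{u,v\}$ with $u\in V_i$, $v\in V_j$ is an edge of $G$ of colour $c$.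
   Formalization: G is taken to be the complete graph on n vertices (and H nonempty): for arbitrary G the claim fails, e.g. a balanced 2-colouring of K_{m,m} with ε=1/5 is triangle-free, so no part of size α log n can induce a complete graph. -}

module Defs where

open import Data.Nat.Base as ℕ using (ℕ; zero; suc)
import Data.Nat.Properties as ℕ
open import Data.Integer.Base as ℤ using (+_)
import Data.Integer.Properties as ℤ
import Data.Rational.Unnormalised.Base as ℚᵘ
import Data.Rational.Unnormalised.Properties as ℚᵘ
open import Data.Rational.Base
open import Data.Rational.Properties
open import Data.Rational.Solver using (module +-*-Solver)
open import Data.Maybe.Base using (Maybe; just; nothing)
import Data.Maybe.Properties as Maybe
open import Data.Fin.Base using (Fin)
import Data.Fin.Properties as Fin
open import Data.Fin.Subset as Subset using (Subset; _∈_; _∩_; Empty)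
open import Data.Vec.Base using (tabulate)
open import Data.Product.Base using (∃-syntax; _×_; _,_; proj₁; proj₂)
open import Data.Sum.Base using (inj₁; inj₂)
open import Relation.Nullary.Decidable using (does; yes; no)
open import Relation.Nullary.Negation using (contradiction)
open import Relation.Binary.PropositionalEquality

open +-*-Solver using (solve; _:+_; _:*_; _:-_; :-_; _:=_; con)

------------------------------------------------------------------------
-- Auxiliary facts about ℚ

0≤1 : 0ℚ ≤ 1ℚ
0≤1 = *≤* (ℤ.+≤+ ℕ.z≤n)

0<1 : 0ℚ < 1ℚ
0<1 = *<* (ℤ.+<+ (ℕ.s≤s ℕ.z≤n))

0≤½ : 0ℚ ≤ ½
0≤½ = *≤* (ℤ.+≤+ ℕ.z≤n)

0<* : ∀ {p q} → 0ℚ < p → 0ℚ < q → 0ℚ < p * q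
0<* {p} {q} 0<p 0<q = subst (_< p * q) (*-zeroʳ p) (*-monoʳ-<-pos p {{positive 0<p}} 0<q)

*-mono : ∀ {p q r s} → 0ℚ ≤ r → 0ℚ ≤ q → p ≤ q → r ≤ s → p * r ≤ q * s
*-mono {p} {q} {r} {s} 0≤r 0≤q p≤q r≤s = ≤-trans
  (*-monoʳ-≤-nonNeg r {{nonNegative 0≤r}} p≤q) (*-monoˡ-≤-nonNeg q {{nonNegative 0≤q}} r≤s)

0≤* : ∀ {p q} → 0ℚ ≤ p → 0ℚ ≤ q → 0ℚ ≤ p * q
0≤* {p} {q} 0≤p 0≤q = subst (_≤ p * q) (*-zeroʳ p) (*-mono {p} ≤-refl 0≤p ≤-refl 0≤q)

p≤∣p∣ : ∀ p → p ≤ ∣ p ∣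
p≤∣p∣ p with ≤-total 0ℚ p
... | inj₁ 0≤p = ≤-reflexive (sym (0≤p⇒∣p∣≡p 0≤p))
... | inj₂ p≤0 = ≤-trans p≤0 (0≤∣p∣ p)

∣p-r∣≤ : ∀ p q r → ∣ p - r ∣ ≤ ∣ p - q ∣ + ∣ q - r ∣
∣p-r∣≤ p q r = subst (λ z → ∣ z ∣ ≤ ∣ p - q ∣ + ∣ q - r ∣)
  (solve 3 (λ p q r → (p :- q) :+ (q :- r) := p :- r) refl p q r)
  (∣p+q∣≤∣p∣+∣q∣ (p - q) (q - r))

∣p-q∣-sym : ∀ p q → ∣ p - q ∣ ≡ ∣ q - p ∣
∣p-q∣-sym p q = trans (sym (∣-p∣≡∣p∣ (p - q)))
  (cong ∣_∣ (solve 2 (λ p q → :- (p :- q) := q :- p) refl p q))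

½+½ : ∀ p → ½ * p + ½ * p ≡ p
½+½ p = trans (sym (*-distribʳ-+ p ½ ½)) (*-identityˡ p)

-- Totalised reciprocal, 0 ↦ 0.
inv : ℚ → ℚ
inv p with p ≟ 0ℚ
... | yes _  = 0ℚ
... | no p≢0 = (1/ p) {{≢-nonZero p≢0}}

p*inv : ∀ {p} → 0ℚ < p → p * inv p ≡ 1ℚ
p*inv {p} 0<p with p ≟ 0ℚ
... | yes p≡0 = contradiction (sym p≡0) (<⇒≢ 0<p)
... | no p≢0  = *-inverseʳ p {{≢-nonZero p≢0}}

0<inv : ∀ {p} → 0ℚ < p → 0ℚ < inv p
0<inv {p} 0<p = *-cancelˡ-<-nonNeg p {{nonNegative (<⇒≤ 0<p)}}
  (subst₂ _<_ (sym (*-zeroʳ p)) (sym (p*inv 0<p)) 0<1)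

inv-anti : ∀ {p q} → 0ℚ < p → p ≤ q → inv q ≤ inv p
inv-anti {p} {q} 0<p p≤q = *-cancelˡ-≤-pos p {{positive 0<p}} (begin
  p * inv q ≤⟨ *-monoʳ-≤-nonNeg (inv q) {{nonNegative (<⇒≤ (0<inv 0<q))}} p≤q ⟩
  q * inv q ≡⟨ p*inv 0<q ⟩
  1ℚ        ≡⟨ sym (p*inv 0<p) ⟩
  p * inv p ∎)
  where
  open ≤-Reasoning
  0<q : 0ℚ < q
  0<q = <-≤-trans 0<p p≤q

inv-diff : ∀ {p q} → 0ℚ < p → 0ℚ < q → inv p - inv q ≡ (q - p) * (inv p * inv q)
inv-diff {p} {q} 0<p 0<q = begin
  inv p - inv q
    ≡⟨ cong₂ _-_ (sym (*-identityˡ (inv p))) (sym (*-identityˡ (inv q))) ⟩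
  1ℚ * inv p - 1ℚ * inv q
    ≡⟨ cong₂ (λ a b → a * inv p - b * inv q) (sym (p*inv 0<q)) (sym (p*inv 0<p)) ⟩
  (q * inv q) * inv p - (p * inv p) * inv q
    ≡⟨ solve 4 (λ p q a b → (q :* b) :* a :- (p :* a) :* b := (q :- p) :* (a :* b)) refl p q (inv p) (inv q) ⟩
  (q - p) * (inv p * inv q) ∎
  where open ≡-Reasoning

∣inv*inv∣≤ : ∀ {d p q} → 0ℚ < d → d ≤ p → d ≤ q → ∣ inv p * inv q ∣ ≤ inv d * inv d
∣inv*inv∣≤ {d} {p} {q} 0<d d≤p d≤q = subst (_≤ inv d * inv d) (sym (0≤p⇒∣p∣≡p (0≤* 0≤p⁻¹ 0≤q⁻¹)))
  (*-mono 0≤q⁻¹ (<⇒≤ (0<inv 0<d)) (inv-anti 0<d d≤p) (inv-anti 0<d d≤q))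
  where
  0≤p⁻¹ : 0ℚ ≤ inv p
  0≤p⁻¹ = <⇒≤ (0<inv (<-≤-trans 0<d d≤p))
  0≤q⁻¹ : 0ℚ ≤ inv q
  0≤q⁻¹ = <⇒≤ (0<inv (<-≤-trans 0<d d≤q))

------------------------------------------------------------------------
-- Real numbers as Cauchy sequences of rationals

Cauchy : (ℕ → ℚ) → Set
Cauchy x = ∀ δ → 0ℚ < δ → ∃[ N ] (∀ m n → N ℕ.≤ m → N ℕ.≤ n → ∣ x m - x n ∣ ≤ δ)

record ℝ : Set where
  constructor mkℝ
  field
    seq    : ℕ → ℚ
    cauchy : Cauchy seq
open ℝ public

infix 4 _≤ℝ_ _<ℝ_

_≤ℝ_ : ℝ → ℝ → Set
x ≤ℝ y = ∀ δ → 0ℚ < δ → ∃[ N ] (∀ n → N ℕ.≤ n → seq x n ≤ seq y n + δ)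

_<ℝ_ : ℝ → ℝ → Set
x <ℝ y = ∃[ δ ] (0ℚ < δ × ∃[ N ] (∀ n → N ℕ.≤ n → seq x n + δ ≤ seq y n))

cauchy-by : ∀ x K → 0ℚ < K →
  (∀ δ → 0ℚ < δ → ∃[ N ] (∀ m n → N ℕ.≤ m → N ℕ.≤ n → ∣ x m - x n ∣ ≤ K * δ)) → Cauchy x
cauchy-by x K 0<K h δ 0<δ with h (inv K * δ) (0<* (0<inv 0<K) 0<δ)
... | N , b = N , λ m n N≤m N≤n → subst (∣ x m - x n ∣ ≤_) eq (b m n N≤m N≤n)
  where
  eq : K * (inv K * δ) ≡ δ
  eq = trans (sym (*-assoc K (inv K) δ)) (trans (cong (_* δ) (p*inv 0<K)) (*-identityˡ δ))

bounded : ∀ x → Cauchy x → ∃[ B ] (0ℚ < B × ∃[ N ] (∀ n → N ℕ.≤ n → ∣ x n ∣ ≤ B))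
bounded x c with c 1ℚ 0<1
... | N , h = 1ℚ + ∣ x N ∣ ,
  <-≤-trans 0<1 (subst (_≤ 1ℚ + ∣ x N ∣) (+-identityʳ 1ℚ) (+-monoʳ-≤ 1ℚ (0≤∣p∣ (x N)))) ,
  N , λ n N≤n → ≤-trans
    (subst (λ z → ∣ z ∣ ≤ ∣ x n - x N ∣ + ∣ x N ∣)
      (solve 2 (λ a b → (a :- b) :+ b := a) refl (x n) (x N))
      (∣p+q∣≤∣p∣+∣q∣ (x n - x N) (x N)))
    (+-monoˡ-≤ ∣ x N ∣ (h n N N≤n ℕ.≤-refl))

fromℚ : ℚ → ℝ
fromℚ q = mkℝ (λ _ → q) λ δ 0<δ → 0 , λ _ _ _ _ →
  subst (λ z → ∣ z ∣ ≤ δ) (sym (+-inverseʳ q)) (<⇒≤ 0<δ)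

fromℕ : ℕ → ℝ
fromℕ n = fromℚ (+ n / 1)

0ℝ : ℝ
0ℝ = fromℕ 0

fromℕ-pos : ∀ n → .{{ℕ.NonZero n}} → 0ℝ <ℝ fromℕ n
fromℕ-pos n@(suc _) = q , positive⁻¹ q {{q⁺}} , 0 , λ _ _ → ≤-reflexive (+-identityˡ q)
  where
  q : ℚ
  q = + n / 1
  q⁺ : Positive q
  q⁺ = normalize-pos n 1

split : ∀ a b c e {n} → (a ℕ.⊔ b) ℕ.⊔ (c ℕ.⊔ e) ℕ.≤ n → a ℕ.≤ n × b ℕ.≤ n × c ℕ.≤ n × e ℕ.≤ n
split a b c e h =
  let l = ℕ.m⊔n≤o⇒m≤o (a ℕ.⊔ b) (c ℕ.⊔ e) h
      r = ℕ.m⊔n≤o⇒n≤o (a ℕ.⊔ b) (c ℕ.⊔ e) h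
  in ℕ.m⊔n≤o⇒m≤o a b l , ℕ.m⊔n≤o⇒n≤o a b l , ℕ.m⊔n≤o⇒m≤o c e r , ℕ.m⊔n≤o⇒n≤o c e r

infixl 7 _*ℝ_

_*ℝ_ : ℝ → ℝ → ℝ
mkℝ x cx *ℝ mkℝ y cy = mkℝ (λ n → x n * y n) (go (bounded x cx) (bounded y cy))
  where
  go : ∃[ B ] (0ℚ < B × ∃[ N ] (∀ n → N ℕ.≤ n → ∣ x n ∣ ≤ B)) →
       ∃[ B ] (0ℚ < B × ∃[ N ] (∀ n → N ℕ.≤ n → ∣ y n ∣ ≤ B)) →
       Cauchy (λ n → x n * y n)
  go (B , 0<B , N₁ , hx) (B′ , 0<B′ , N₂ , hy) =
    cauchy-by (λ n → x n * y n) (B + B′) (+-mono-< 0<B 0<B′) λ δ 0<δ →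
    let M₁ , kx = cx δ 0<δ
        M₂ , ky = cy δ 0<δ
    in (N₁ ℕ.⊔ N₂) ℕ.⊔ (M₁ ℕ.⊔ M₂) , λ m n Nm Nn →
    let m₁ , _  , m₃ , m₄ = split N₁ N₂ M₁ M₂ Nm
        _  , n₂ , n₃ , n₄ = split N₁ N₂ M₁ M₂ Nn
    in begin
      ∣ x m * y m - x n * y n ∣
        ≡⟨ cong ∣_∣ (solve 4 (λ a b c d → a :* b :- c :* d := a :* (b :- d) :+ (a :- c) :* d)
             refl (x m) (y m) (x n) (y n)) ⟩
      ∣ x m * (y m - y n) + (x m - x n) * y n ∣
        ≤⟨ ∣p+q∣≤∣p∣+∣q∣ (x m * (y m - y n)) ((x m - x n) * y n) ⟩
      ∣ x m * (y m - y n) ∣ + ∣ (x m - x n) * y n ∣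
        ≡⟨ cong₂ _+_ (∣p*q∣≡∣p∣*∣q∣ (x m) (y m - y n)) (∣p*q∣≡∣p∣*∣q∣ (x m - x n) (y n)) ⟩
      ∣ x m ∣ * ∣ y m - y n ∣ + ∣ x m - x n ∣ * ∣ y n ∣
        ≤⟨ +-mono-≤
             (*-mono (0≤∣p∣ (y m - y n)) (<⇒≤ 0<B) (hx m m₁) (ky m n m₄ n₄))
             (*-mono (0≤∣p∣ (y n)) (<⇒≤ 0<δ) (kx m n m₃ n₃) (hy n n₂)) ⟩
      B * δ + δ * B′
        ≡⟨ solve 3 (λ b c d → b :* d :+ d :* c := (b :+ c) :* d) refl B B′ δ ⟩
      (B + B′) * δ ∎
    where open ≤-Reasoning

eventually≥ : ∀ x → 0ℝ <ℝ x → ∃[ d ] (0ℚ < d × ∃[ N ] (∀ n → N ℕ.≤ n → d ≤ seq x n))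
eventually≥ x (d , 0<d , N , h) = d , 0<d , N , λ n N≤n →
  subst (_≤ seq x n) (+-identityˡ d) (h n N≤n)

recip : (x : ℝ) → 0ℝ <ℝ x → ℝ
recip x 0<x = mkℝ (λ n → inv (seq x n)) (go (eventually≥ x 0<x))
  where
  go : ∃[ d ] (0ℚ < d × ∃[ N ] (∀ n → N ℕ.≤ n → d ≤ seq x n)) → Cauchy (λ n → inv (seq x n))
  go (d , 0<d , N , h) =
    cauchy-by (λ n → inv (seq x n)) (inv d * inv d) (0<* (0<inv 0<d) (0<inv 0<d)) λ δ 0<δ →
    let M , k = cauchy x δ 0<δ
    in N ℕ.⊔ M , λ m n Nm Nn →
    let a = h m (ℕ.m⊔n≤o⇒m≤o N M Nm)
        b = h n (ℕ.m⊔n≤o⇒m≤o N M Nn)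
        p = seq x m
        q = seq x n
    in begin
      ∣ inv p - inv q ∣                 ≡⟨ cong ∣_∣ (inv-diff (<-≤-trans 0<d a) (<-≤-trans 0<d b)) ⟩
      ∣ (q - p) * (inv p * inv q) ∣     ≡⟨ ∣p*q∣≡∣p∣*∣q∣ (q - p) _ ⟩
      ∣ q - p ∣ * ∣ inv p * inv q ∣
        ≤⟨ *-mono (0≤∣p∣ (inv p * inv q)) (<⇒≤ 0<δ)
             (k n m (ℕ.m⊔n≤o⇒n≤o N M Nn) (ℕ.m⊔n≤o⇒n≤o N M Nm)) (∣inv*inv∣≤ 0<d a b) ⟩
      δ * (inv d * inv d)               ≡⟨ *-comm δ _ ⟩
      (inv d * inv d) * δ ∎
    where open ≤-Reasoning

recip-pos : (x : ℝ) (0<x : 0ℝ <ℝ x) → 0ℝ <ℝ recip x 0<x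
recip-pos x 0<x = go (eventually≥ x 0<x) (bounded (seq x) (cauchy x))
  where
  go : ∃[ d ] (0ℚ < d × ∃[ N ] (∀ n → N ℕ.≤ n → d ≤ seq x n)) →
       ∃[ B ] (0ℚ < B × ∃[ N ] (∀ n → N ℕ.≤ n → ∣ seq x n ∣ ≤ B)) → 0ℝ <ℝ recip x 0<x
  go (d , 0<d , N , h) (B , 0<B , M , k) = inv B , 0<inv 0<B , N ℕ.⊔ M , λ n n≥ →
    subst (_≤ inv (seq x n)) (sym (+-identityˡ (inv B)))
      (inv-anti (<-≤-trans 0<d (h n (ℕ.m⊔n≤o⇒m≤o N M n≥)))
        (≤-trans (p≤∣p∣ _) (k n (ℕ.m⊔n≤o⇒n≤o N M n≥))))

------------------------------------------------------------------------
-- The natural logarithm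

-- The left Riemann sum of f over [0,1] with 2ⁿ equal pieces, by bisection.
riemann : ℕ → (ℚ → ℚ) → ℚ
riemann zero    f = f 0ℚ
riemann (suc n) f = ½ * riemann n (λ t → f (½ * t)) + ½ * riemann n (λ t → f (½ + ½ * t))

In01 : ℚ → Set
In01 t = 0ℚ ≤ t × t ≤ 1ℚ

left-half : ∀ {t} → In01 t → In01 (½ * t)
left-half {t} (0≤t , t≤1) = 0≤* 0≤½ 0≤t ,
  ≤-trans (*-monoˡ-≤-nonNeg ½ t≤1) (*≤* (ℤ.+≤+ (ℕ.s≤s ℕ.z≤n)))

right-half : ∀ {t} → In01 t → In01 (½ + ½ * t)
right-half {t} (0≤t , t≤1) = +-mono-≤ 0≤½ (0≤* 0≤½ 0≤t) ,
  +-monoʳ-≤ ½ (*-monoˡ-≤-nonNeg ½ t≤1)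

∣½+½∣≤ : ∀ {p q r K} → p ≡ ½ * q + ½ * r → ∣ q ∣ ≤ K → ∣ r ∣ ≤ K → ∣ p ∣ ≤ K
∣½+½∣≤ {p} {q} {r} {K} refl q≤ r≤ = begin
  ∣ ½ * q + ½ * r ∣     ≤⟨ ∣p+q∣≤∣p∣+∣q∣ (½ * q) (½ * r) ⟩
  ∣ ½ * q ∣ + ∣ ½ * r ∣ ≡⟨ cong₂ _+_ (∣p*q∣≡∣p∣*∣q∣ ½ q) (∣p*q∣≡∣p∣*∣q∣ ½ r) ⟩
  ½ * ∣ q ∣ + ½ * ∣ r ∣ ≤⟨ +-mono-≤ (*-monoˡ-≤-nonNeg ½ q≤) (*-monoˡ-≤-nonNeg ½ r≤) ⟩
  ½ * K + ½ * K         ≡⟨ ½+½ K ⟩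
  K ∎
  where open ≤-Reasoning

riemann-close : ∀ n {f g M} → (∀ t → In01 t → ∣ f t - g t ∣ ≤ M) → ∣ riemann n f - riemann n g ∣ ≤ M
riemann-close zero    h = h 0ℚ (≤-refl , 0≤1)
riemann-close (suc n) {f} {g} h = ∣½+½∣≤
  (solve 5 (λ k a b c d → (k :* a :+ k :* b) :- (k :* c :+ k :* d) := k :* (a :- c) :+ k :* (b :- d))
    refl ½ (riemann n (λ t → f (½ * t))) (riemann n (λ t → f (½ + ½ * t)))
           (riemann n (λ t → g (½ * t))) (riemann n (λ t → g (½ + ½ * t))))
  (riemann-close n (λ t i → h _ (left-half i)))
  (riemann-close n (λ t i → h _ (right-half i)))

riemann-const : ∀ n c → riemann n (λ _ → c) ≡ c
riemann-const zero    c = refl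
riemann-const (suc n) c = trans (cong (λ z → ½ * z + ½ * z) (riemann-const n c)) (½+½ c)

half^ : ℕ → ℚ
half^ zero    = 1ℚ
half^ (suc n) = ½ * half^ n

Lipschitz : ℚ → (ℚ → ℚ) → Set
Lipschitz K f = ∀ s t → In01 s → In01 t → ∣ f s - f t ∣ ≤ K * ∣ s - t ∣

lipschitz-half : ∀ {K f} c → (∀ {t} → In01 t → In01 (c + ½ * t)) →
  Lipschitz K f → Lipschitz (½ * K) (λ t → f (c + ½ * t))
lipschitz-half {K} {f} c in01 L s t is it = ≤-trans (L _ _ (in01 is) (in01 it)) (≤-reflexive (begin
  K * ∣ (c + ½ * s) - (c + ½ * t) ∣
    ≡⟨ cong (λ z → K * ∣ z ∣) (solve 4 (λ c h s t → (c :+ h :* s) :- (c :+ h :* t) := h :* (s :- t)) refl c ½ s t) ⟩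
  K * ∣ ½ * (s - t) ∣   ≡⟨ cong (K *_) (∣p*q∣≡∣p∣*∣q∣ ½ (s - t)) ⟩
  K * (½ * ∣ s - t ∣)   ≡⟨ solve 3 (λ k h z → k :* (h :* z) := (h :* k) :* z) refl K ½ ∣ s - t ∣ ⟩
  (½ * K) * ∣ s - t ∣ ∎))
  where open ≡-Reasoning

riemann-refine : ∀ n j {K f} → 0ℚ ≤ K → Lipschitz K f → ∣ riemann (n ℕ.+ j) f - riemann n f ∣ ≤ half^ n * K
riemann-refine zero j {K} {f} 0≤K L = begin
  ∣ riemann j f - f 0ℚ ∣ ≡⟨ cong (λ z → ∣ riemann j f - z ∣) (sym (riemann-const j (f 0ℚ))) ⟩
  ∣ riemann j f - riemann j (λ _ → f 0ℚ) ∣ ≤⟨ riemann-close j (λ t i → begin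
     ∣ f t - f 0ℚ ∣   ≤⟨ L t 0ℚ i (≤-refl , 0≤1) ⟩
     K * ∣ t - 0ℚ ∣   ≡⟨ cong (λ z → K * ∣ z ∣) (+-identityʳ t) ⟩
     K * ∣ t ∣        ≡⟨ cong (K *_) (0≤p⇒∣p∣≡p (proj₁ i)) ⟩
     K * t            ≤⟨ *-monoˡ-≤-nonNeg K {{nonNegative 0≤K}} (proj₂ i) ⟩
     K * 1ℚ           ≡⟨ *-comm K 1ℚ ⟩
     1ℚ * K ∎) ⟩
  1ℚ * K ∎
  where open ≤-Reasoning
riemann-refine (suc n) j {K} {f} 0≤K L = subst (∣ riemann (suc n ℕ.+ j) f - riemann (suc n) f ∣ ≤_)
  (solve 3 (λ w h k → w :* (h :* k) := (h :* w) :* k) refl (half^ n) ½ K)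
  (∣½+½∣≤
    (solve 5 (λ k a b c d → (k :* a :+ k :* b) :- (k :* c :+ k :* d) := k :* (a :- c) :+ k :* (b :- d))
      refl ½ (riemann (n ℕ.+ j) (λ t → f (½ * t))) (riemann (n ℕ.+ j) (λ t → f (½ + ½ * t)))
             (riemann n (λ t → f (½ * t))) (riemann n (λ t → f (½ + ½ * t))))
    (riemann-refine n j 0≤½K Lˡ)
    (riemann-refine n j 0≤½K (lipschitz-half {K} {f} ½ right-half L)))
  where
  0≤½K : 0ℚ ≤ ½ * K
  0≤½K = 0≤* 0≤½ 0≤K
  Lˡ : Lipschitz (½ * K) (λ t → f (½ * t))
  Lˡ s t is it = subst₂ (λ a b → ∣ f a - f b ∣ ≤ ½ * K * ∣ s - t ∣) (+-identityˡ (½ * s)) (+-identityˡ (½ * t))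
    (lipschitz-half {K} {f} 0ℚ (λ {t} i → subst In01 (sym (+-identityˡ (½ * t))) (left-half i)) L s t is it)

0<half^ : ∀ n → 0ℚ < half^ n
0<half^ zero    = 0<1
0<half^ (suc n) = 0<* {½} (*<* (ℤ.+<+ (ℕ.s≤s ℕ.z≤n))) (0<half^ n)

nat : ℕ → ℚ
nat zero    = 0ℚ
nat (suc n) = 1ℚ + nat n

0≤nat : ∀ n → 0ℚ ≤ nat n
0≤nat zero    = ≤-refl
0≤nat (suc n) = +-mono-≤ 0≤1 (0≤nat n)

nat-mono : ∀ {m n} → m ℕ.≤ n → nat m ≤ nat n
nat-mono {n = n} ℕ.z≤n = 0≤nat n
nat-mono (ℕ.s≤s m≤n)   = +-monoʳ-≤ 1ℚ (nat-mono m≤n)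

toℚᵘ-nat : ∀ n → toℚᵘ (nat n) ℚᵘ.≃ ℚᵘ.mkℚᵘ (+ n) 0
toℚᵘ-nat zero    = ℚᵘ.≃-refl
toℚᵘ-nat (suc n) = ℚᵘ.≃-trans (toℚᵘ-homo-+ 1ℚ (nat n)) (ℚᵘ.≃-trans (ℚᵘ.+-congʳ ℚᵘ.1ℚᵘ (toℚᵘ-nat n))
  (ℚᵘ.*≡* (cong (λ z → (+ 1 ℤ.+ z) ℤ.* + 1) (ℤ.*-identityʳ (+ n)))))

archimedean : ∀ q → ∃[ n ] q ≤ nat n
archimedean q@(mkℚ (+ a) d _) = a , toℚᵘ-cancel-≤ (ℚᵘ.≤-trans
  (ℚᵘ.*≤* (ℤ.*-monoˡ-≤-nonNeg (+ a) (ℤ.+≤+ (ℕ.s≤s ℕ.z≤n))))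
  (ℚᵘ.≤-reflexive (ℚᵘ.≃-sym (toℚᵘ-nat a))))
archimedean (mkℚ ℤ.-[1+ a ] d _) = 0 , *≤* ℤ.-≤+

half^*nat≤1 : ∀ n → half^ n * nat n ≤ 1ℚ
half^*nat≤1 n = ≤-trans (*-monoˡ-≤-nonNeg (half^ n) {{nonNegative (<⇒≤ (0<half^ n))}} (n≤1+n n)) (go n)
  where
  n≤1+n : ∀ n → nat n ≤ 1ℚ + nat n
  n≤1+n n = subst (_≤ 1ℚ + nat n) (+-identityˡ (nat n)) (+-monoˡ-≤ (nat n) 0≤1)
  go : ∀ n → half^ n * (1ℚ + nat n) ≤ 1ℚ
  go zero    = ≤-refl
  go (suc n) = begin
    (½ * half^ n) * (1ℚ + nat (suc n))
      ≤⟨ *-monoˡ-≤-nonNeg (½ * half^ n) {{nonNegative (<⇒≤ (0<half^ (suc n)))}}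
           (+-monoˡ-≤ (nat (suc n)) (subst (_≤ nat (suc n)) (+-identityʳ 1ℚ) (+-monoʳ-≤ 1ℚ (0≤nat n)))) ⟩
    (½ * half^ n) * (nat (suc n) + nat (suc n))
      ≡⟨ solve 3 (λ h w k → (h :* w) :* (k :+ k) := h :* (w :* k) :+ h :* (w :* k)) refl ½ (half^ n) (nat (suc n)) ⟩
    ½ * (half^ n * nat (suc n)) + ½ * (half^ n * nat (suc n))
      ≡⟨ ½+½ _ ⟩
    half^ n * nat (suc n)
      ≤⟨ go n ⟩
    1ℚ ∎
    where open ≤-Reasoning

half^-small : ∀ δ → 0ℚ < δ → ∃[ N ] (∀ n → N ℕ.≤ n → half^ n ≤ δ)
half^-small δ 0<δ with archimedean (inv δ)
... | N , h = N , λ n N≤n → begin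
  half^ n                   ≡⟨ sym (*-identityʳ (half^ n)) ⟩
  half^ n * 1ℚ              ≡⟨ cong (half^ n *_) (sym (trans (*-comm (inv δ) δ) (p*inv 0<δ))) ⟩
  half^ n * (inv δ * δ)     ≡⟨ sym (*-assoc (half^ n) (inv δ) δ) ⟩
  (half^ n * inv δ) * δ     ≤⟨ *-monoʳ-≤-nonNeg δ {{nonNegative (<⇒≤ 0<δ)}} (≤-trans
                                 (*-monoˡ-≤-nonNeg (half^ n) {{nonNegative (<⇒≤ (0<half^ n))}} (≤-trans h (nat-mono N≤n)))
                                 (half^*nat≤1 n)) ⟩
  1ℚ * δ                    ≡⟨ *-identityˡ δ ⟩
  δ ∎
  where open ≤-Reasoning

-- log x = ∫₁ˣ ds/s = ∫₀¹ (x − 1)/(1 + t(x − 1)) dt.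
integrand : ℚ → ℚ → ℚ
integrand q t = (q - 1ℚ) * inv (1ℚ + t * (q - 1ℚ))

denominator≥ : ∀ {d q t} → d ≤ 1ℚ → d ≤ q → In01 t → d ≤ 1ℚ + t * (q - 1ℚ)
denominator≥ {d} {q} {t} d≤1 d≤q (0≤t , t≤1) = begin
  d                                ≡⟨ solve 2 (λ d t → d := (con 1ℚ :- t) :* d :+ t :* d) refl d t ⟩
  (1ℚ - t) * d + t * d             ≤⟨ +-mono-≤ (*-monoˡ-≤-nonNeg (1ℚ - t) {{nonNegative 0≤1-t}} d≤1)
                                               (*-monoˡ-≤-nonNeg t {{nonNegative 0≤t}} d≤q) ⟩
  (1ℚ - t) * 1ℚ + t * q            ≡⟨ solve 2 (λ q t → (con 1ℚ :- t) :* con 1ℚ :+ t :* q := con 1ℚ :+ t :* (q :- con 1ℚ)) refl q t ⟩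
  1ℚ + t * (q - 1ℚ) ∎
  where
  open ≤-Reasoning
  0≤1-t : 0ℚ ≤ 1ℚ - t
  0≤1-t = subst (_≤ 1ℚ - t) (+-inverseʳ t) (+-monoˡ-≤ (- t) t≤1)

integrand-diff : ∀ {d p q s t} → 0ℚ < d →
  d ≤ 1ℚ → d ≤ p → d ≤ q → In01 s → In01 t →
  integrand p s - integrand q t ≡
    ((p - q) + (p - 1ℚ) * (q - 1ℚ) * (t - s)) * (inv (1ℚ + s * (p - 1ℚ)) * inv (1ℚ + t * (q - 1ℚ)))
integrand-diff {d} {p} {q} {s} {t} 0<d d≤1 d≤p d≤q is it = begin
  (p - 1ℚ) * a - (q - 1ℚ) * b
    ≡⟨ cong₂ _-_ (sym (*-identityʳ ((p - 1ℚ) * a))) (sym (*-identityʳ ((q - 1ℚ) * b))) ⟩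
  (p - 1ℚ) * a * 1ℚ - (q - 1ℚ) * b * 1ℚ
    ≡⟨ cong₂ (λ u v → (p - 1ℚ) * a * u - (q - 1ℚ) * b * v)
         (sym (p*inv {1ℚ + t * (q - 1ℚ)} (<-≤-trans 0<d (denominator≥ d≤1 d≤q it))))
         (sym (p*inv {1ℚ + s * (p - 1ℚ)} (<-≤-trans 0<d (denominator≥ d≤1 d≤p is)))) ⟩
  (p - 1ℚ) * a * ((1ℚ + t * (q - 1ℚ)) * b) - (q - 1ℚ) * b * ((1ℚ + s * (p - 1ℚ)) * a)
    ≡⟨ solve 7 (λ p q s t a b e →
         (p :- e) :* a :* ((e :+ t :* (q :- e)) :* b) :- (q :- e) :* b :* ((e :+ s :* (p :- e)) :* a)
         := (e :* (p :- q) :+ (p :- e) :* (q :- e) :* (t :- s)) :* (a :* b)) refl p q s t a b 1ℚ ⟩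
  (1ℚ * (p - q) + (p - 1ℚ) * (q - 1ℚ) * (t - s)) * (a * b)
    ≡⟨ cong (λ z → (z + (p - 1ℚ) * (q - 1ℚ) * (t - s)) * (a * b)) (*-identityˡ (p - q)) ⟩
  ((p - q) + (p - 1ℚ) * (q - 1ℚ) * (t - s)) * (a * b) ∎
  where
  open ≡-Reasoning
  a b : ℚ
  a = inv (1ℚ + s * (p - 1ℚ))
  b = inv (1ℚ + t * (q - 1ℚ))

∣integrand-diff∣≤ : ∀ {d p q s t A} → 0ℚ < d →
  d ≤ 1ℚ → d ≤ p → d ≤ q → In01 s → In01 t →
  ∣ (p - q) + (p - 1ℚ) * (q - 1ℚ) * (t - s) ∣ ≤ A →
  ∣ integrand p s - integrand q t ∣ ≤ A * (inv d * inv d)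
∣integrand-diff∣≤ {d} {p} {q} {s} {t} {A} 0<d d≤1 d≤p d≤q is it h = begin
  ∣ integrand p s - integrand q t ∣
    ≡⟨ cong ∣_∣ (integrand-diff 0<d d≤1 d≤p d≤q is it) ⟩
  ∣ u * (inv (1ℚ + s * (p - 1ℚ)) * inv (1ℚ + t * (q - 1ℚ))) ∣
    ≡⟨ ∣p*q∣≡∣p∣*∣q∣ u _ ⟩
  ∣ u ∣ * ∣ inv (1ℚ + s * (p - 1ℚ)) * inv (1ℚ + t * (q - 1ℚ)) ∣
    ≤⟨ *-mono (0≤∣p∣ (inv (1ℚ + s * (p - 1ℚ)) * inv (1ℚ + t * (q - 1ℚ)))) (≤-trans (0≤∣p∣ u) h) h
         (∣inv*inv∣≤ 0<d (denominator≥ d≤1 d≤p is) (denominator≥ d≤1 d≤q it)) ⟩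
  A * (inv d * inv d) ∎
  where
  open ≤-Reasoning
  u : ℚ
  u = (p - q) + (p - 1ℚ) * (q - 1ℚ) * (t - s)

integrand-lipschitz : ∀ {d q B} → 0ℚ < d → d ≤ 1ℚ → d ≤ q → ∣ q - 1ℚ ∣ ≤ B →
  Lipschitz (B * B * (inv d * inv d)) (integrand q)
integrand-lipschitz {d} {q} {B} 0<d d≤1 d≤q q≤B s t is it = subst (∣ integrand q s - integrand q t ∣ ≤_)
  (solve 3 (λ b z i → b :* z :* i := b :* i :* z) refl (B * B) ∣ s - t ∣ (inv d * inv d))
  (∣integrand-diff∣≤ 0<d d≤1 d≤q d≤q is it (begin
    ∣ (q - q) + (q - 1ℚ) * (q - 1ℚ) * (t - s) ∣
      ≡⟨ cong (λ z → ∣ z + (q - 1ℚ) * (q - 1ℚ) * (t - s) ∣) (+-inverseʳ q) ⟩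
    ∣ 0ℚ + (q - 1ℚ) * (q - 1ℚ) * (t - s) ∣
      ≡⟨ cong ∣_∣ (+-identityˡ ((q - 1ℚ) * (q - 1ℚ) * (t - s))) ⟩
    ∣ (q - 1ℚ) * (q - 1ℚ) * (t - s) ∣
      ≡⟨ trans (∣p*q∣≡∣p∣*∣q∣ ((q - 1ℚ) * (q - 1ℚ)) (t - s))
           (cong₂ _*_ (∣p*q∣≡∣p∣*∣q∣ (q - 1ℚ) (q - 1ℚ)) (∣p-q∣-sym t s)) ⟩
    ∣ q - 1ℚ ∣ * ∣ q - 1ℚ ∣ * ∣ s - t ∣
      ≤⟨ *-monoʳ-≤-nonNeg ∣ s - t ∣ {{nonNegative (0≤∣p∣ (s - t))}}
           (*-mono (0≤∣p∣ (q - 1ℚ)) (≤-trans (0≤∣p∣ (q - 1ℚ)) q≤B) q≤B q≤B) ⟩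
    B * B * ∣ s - t ∣ ∎))
  where open ≤-Reasoning

integrand-close : ∀ {d p q δ} → 0ℚ < d → d ≤ 1ℚ → d ≤ p → d ≤ q → ∣ p - q ∣ ≤ δ →
  ∀ t → In01 t → ∣ integrand p t - integrand q t ∣ ≤ δ * (inv d * inv d)
integrand-close {d} {p} {q} {δ} 0<d d≤1 d≤p d≤q h t it = ∣integrand-diff∣≤ 0<d d≤1 d≤p d≤q it it
  (subst (λ z → ∣ z ∣ ≤ δ)
    (solve 4 (λ p q t e → p :- q := (p :- q) :+ (p :- e) :* (q :- e) :* (t :- t)) refl p q t 1ℚ) h)

log : (x : ℝ) → 0ℝ <ℝ x → ℝ
log x 0<x = mkℝ L (go (eventually≥ x 0<x) (bounded (seq x) (cauchy x)))
  where
  L : ℕ → ℚ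
  L n = riemann n (integrand (seq x n))

  go : ∃[ d ] (0ℚ < d × ∃[ N ] (∀ n → N ℕ.≤ n → d ≤ seq x n)) →
       ∃[ B ] (0ℚ < B × ∃[ N ] (∀ n → N ℕ.≤ n → ∣ seq x n ∣ ≤ B)) → Cauchy L
  go (d₀ , 0<d₀ , N₁ , lo) (B₀ , 0<B₀ , N₂ , hi) = cauchy-by L (I + K) 0<I+K λ δ 0<δ →
    let M₁ , cx = cauchy x δ 0<δ
        M₂ , hs = half^-small δ 0<δ
    in (N₁ ℕ.⊔ N₂) ℕ.⊔ (M₁ ℕ.⊔ M₂) , λ m n Nm Nn →
    let m₁ , m₂ , m₃ , m₄ = split N₁ N₂ M₁ M₂ Nm
        n₁ , n₂ , n₃ , n₄ = split N₁ N₂ M₁ M₂ Nn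
    in case δ m n (ok m₁ m₂) (ok n₁ n₂) (cx m n m₃ n₃) (hs m m₄) (hs n n₄)
    where
    d B I K : ℚ
    d = d₀ ⊓ 1ℚ
    B = B₀ + 1ℚ
    I = inv d * inv d
    K = B * B * I

    0<d : 0ℚ < d
    0<d with ≤-total d₀ 1ℚ
    ... | inj₁ d₀≤1 = subst (0ℚ <_) (sym (p≤q⇒p⊓q≡p d₀≤1)) 0<d₀
    ... | inj₂ 1≤d₀ = subst (0ℚ <_) (sym (p≥q⇒p⊓q≡q 1≤d₀)) 0<1

    d≤1 : d ≤ 1ℚ
    d≤1 = p⊓q≤q d₀ 1ℚ

    0<I : 0ℚ < I
    0<I = 0<* (0<inv 0<d) (0<inv 0<d)

    0<K : 0ℚ < K
    0<K = 0<* (0<* 0<B 0<B) 0<I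
      where
      0<B : 0ℚ < B
      0<B = +-mono-< 0<B₀ 0<1

    0<I+K : 0ℚ < I + K
    0<I+K = +-mono-< 0<I 0<K

    ok : ∀ {n} → N₁ ℕ.≤ n → N₂ ℕ.≤ n → d ≤ seq x n × ∣ seq x n - 1ℚ ∣ ≤ B
    ok {n} a b = ≤-trans (p⊓q≤p d₀ 1ℚ) (lo n a) ,
      ≤-trans (∣p-q∣≤∣p∣+∣q∣ (seq x n) 1ℚ) (+-monoˡ-≤ 1ℚ (hi n b))

    refine : ∀ {δ m n} → m ℕ.≤ n → half^ m ≤ δ → d ≤ seq x n × ∣ seq x n - 1ℚ ∣ ≤ B →
      ∣ riemann n (integrand (seq x n)) - riemann m (integrand (seq x n)) ∣ ≤ δ * K
    refine {δ} {m} {n} m≤n hm (d≤ , ≤B) = ≤-trans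
      (subst (λ k → ∣ riemann k (integrand (seq x n)) - riemann m (integrand (seq x n)) ∣ ≤ half^ m * K)
        (ℕ.m+[n∸m]≡n m≤n)
        (riemann-refine m (n ℕ.∸ m) (<⇒≤ 0<K) (integrand-lipschitz 0<d d≤1 d≤ ≤B)))
      (*-monoʳ-≤-nonNeg K {{nonNegative (<⇒≤ 0<K)}} hm)

    half : ∀ {δ m n} → m ℕ.≤ n → half^ m ≤ δ → ∣ seq x m - seq x n ∣ ≤ δ →
      d ≤ seq x m × ∣ seq x m - 1ℚ ∣ ≤ B → d ≤ seq x n × ∣ seq x n - 1ℚ ∣ ≤ B →
      ∣ L m - L n ∣ ≤ (I + K) * δ
    half {δ} {m} {n} m≤n hm h om on = begin
      ∣ L m - L n ∣
        ≤⟨ ∣p-r∣≤ (L m) X (L n) ⟩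
      ∣ L m - X ∣ + ∣ X - L n ∣
        ≤⟨ +-mono-≤
             (riemann-close m (integrand-close 0<d d≤1 (proj₁ om) (proj₁ on) h))
             (subst (_≤ δ * K) (∣p-q∣-sym (L n) X) (refine m≤n hm on)) ⟩
      δ * I + δ * K
        ≡⟨ solve 3 (λ δ j k → δ :* j :+ δ :* k := (j :+ k) :* δ) refl δ I K ⟩
      (I + K) * δ ∎
      where
      open ≤-Reasoning
      X : ℚ
      X = riemann m (integrand (seq x n))

    case : ∀ δ m n →
      d ≤ seq x m × ∣ seq x m - 1ℚ ∣ ≤ B → d ≤ seq x n × ∣ seq x n - 1ℚ ∣ ≤ B →
      ∣ seq x m - seq x n ∣ ≤ δ → half^ m ≤ δ → half^ n ≤ δ → ∣ L m - L n ∣ ≤ (I + K) * δ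
    case δ m n om on h hm hn with ℕ.≤-total m n
    ... | inj₁ m≤n = half m≤n hm h om on
    ... | inj₂ n≤m = subst (_≤ (I + K) * δ) (∣p-q∣-sym (L n) (L m))
      (half n≤m hn (subst (_≤ δ) (∣p-q∣-sym (seq x m) (seq x n)) h) on om)

------------------------------------------------------------------------
-- Edge-coloured graphs

-- A simple graph on Fin n with an r-edge-colouring: colour u v ≡ just c if uv is an
-- edge of colour c, and colour u v ≡ nothing if uv is not an edge.
record ColouredGraph (r n : ℕ) : Set where
  field
    colour      : Fin n → Fin n → Maybe (Fin r)
    symmetric   : ∀ u v → colour u v ≡ colour v u
    irreflexive : ∀ v → colour v v ≡ nothing
open ColouredGraph public

module _ {r n : ℕ} (G : ColouredGraph r n) where

  -- Locally balanced colourings of, say, K_{m,m} contain no clique on three vertices,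
  -- hence no homogeneous blow-up with large parts.
  Complete : Set
  Complete = ∀ u v → u ≢ v → ∃[ c ] colour G u v ≡ just c

  neighbours : Fin r → Fin n → Subset n
  neighbours c v = tabulate λ u → does (Maybe.≡-dec Fin._≟_ (colour G v u) (just c))

  -- The number of edges of colour c incident to v.
  degree : Fin r → Fin n → ℕ
  degree c v = Subset.∣ neighbours c v ∣

  LocallyBalanced : ℝ → Set
  LocallyBalanced ε = ∀ v c → ε *ℝ fromℕ n ≤ℝ fromℕ (degree c v)

  Unibalanced : Set
  Unibalanced = ∀ v c → ∃[ u ] colour G v u ≡ just c

  MonochromaticClique : Subset n → Set
  MonochromaticClique S = ∃[ c ] (∀ u v → u ∈ S → v ∈ S → u ≢ v → colour G u v ≡ just c)

record HomogeneousBlowUp {r n k : ℕ} (t : ℝ) (H : ColouredGraph r k) (G : ColouredGraph r n) : Set where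
  field
    part          : Fin k → Subset n
    disjoint      : ∀ i j → i ≢ j → Empty (part i ∩ part j)
    large         : ∀ i → t ≤ℝ fromℕ Subset.∣ part i ∣
    monochromatic : ∀ i → MonochromaticClique G (part i)
    joined        : ∀ i j c → colour H i j ≡ just c →
                    ∀ u v → u ∈ part i → v ∈ part j → colour G u v ≡ just c

module Submission where

-- If every vertex has at least n/D neighbours of every colour, then a vertex has no neighbour of a
-- given colour among D j random vertices with probability at most (1 − 1/D)^(D j) ≤ 2⁻ʲ. Hence, with
-- j of order log D, a positive proportion of the K-tuples of vertices, K = 1 + D j, induce a
-- unibalanced graph; and 1/ε is at least max(2, D/2), so that K ≤ C.
--
-- The method of conditional expectations turns this into a tree: call a tuple rich if the expected
-- number of missing colours after completing it at random is small; the empty tuple is rich, a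
-- positive proportion of the one-vertex extensions of a rich tuple are rich, and rich K-tuples are
-- unibalanced. As in Nikiforov's theorem on blow-ups of cliques, the tree is climbed with m rows
-- (rich i-tuples) at once, whose entries form i homogeneous parts, m being a small multiple of log n.
-- Averaging gives many vertices richly extending a positive proportion of the rows, and the 2^O(m)
-- patterns of behaviour towards the rows are few compared to n, so that some pattern is shared by a
-- power of n of these vertices. By Ramsey's theorem they contain a monochromatic clique of size m,
-- the next part.

open import Defs
open import Data.Nat using (ℕ; NonZero)
open import Data.Product using (Σ-syntax; ∃-syntax; _×_; _,_; proj₁; proj₂)
open import Data.Bool.Base using (Bool; true; false; if_then_else_)
import Data.Bool.Properties as Bool
open import Data.Fin.Base using (Fin; zero; suc; fromℕ<)
import Data.Fin.Properties as Fin
open import Data.Fin.Subset as Subset using (Subset)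
import Data.Fin.Subset.Properties as Subset
open import Data.List.Base as List using (List; []; _∷_; length; filter; map; take; allFin; zipWith; cartesianProductWith)
open import Data.List.Properties using (length-filter; length-map; length-tabulate; length-take; length-zipWith; length-++; length-replicate)
open import Data.List.Membership.Propositional using (_∈_)
open import Data.List.Membership.Propositional.Properties using (∈-allFin; ∈-map⁺; ∈-map⁻; ∈-filter⁻; ∈-cartesianProductWith⁺)
open import Data.List.Relation.Binary.Sublist.Propositional using (_⊆_; []; _∷_; _∷ʳ_; ⊆-refl; ⊆-trans) renaming (lookup to ∈-resp-⊆)
open import Data.List.Relation.Binary.Sublist.Propositional.Properties using (filter-⊆; take-⊆; All-resp-⊆)
open import Data.List.Relation.Unary.All as All using (All; []; _∷_)
import Data.List.Relation.Unary.All.Properties as All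
open import Data.List.Relation.Unary.AllPairs as AllPairs using (AllPairs; []; _∷_)
import Data.List.Relation.Unary.AllPairs.Properties as AllPairs
open import Data.List.Relation.Unary.Any using (here; there)
open import Data.List.Relation.Unary.Unique.Propositional using (Unique)
import Data.List.Relation.Unary.Unique.Propositional.Properties as Unique
open import Data.Maybe.Base using (Maybe; just; nothing; fromMaybe)
import Data.Maybe.Properties as Maybe
open import Data.Sum.Base as Sum using (_⊎_; inj₁; inj₂)
open import Data.Unit.Base using (tt)
open import Data.Vec.Base as Vec using (Vec; []; _∷_; lookup; toList)
open import Function.Base using (_∘_; id; flip)
open import Relation.Binary.Definitions using (DecidableEquality)
open import Relation.Binary.PropositionalEquality
open import Relation.Nullary.Decidable using (Dec; yes; no; does; map′; from-yes)
open import Relation.Nullary.Negation using (¬_; contradiction)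
open import Relation.Unary using (Decidable)

module Combinatorics where

  open import Data.Nat.Base
  open import Data.Nat.Properties
  open import Data.Nat.DivMod using (m/n*n≤m; m*n/n≡m; /-monoˡ-≤)
  open import Data.Nat.Solver using (module +-*-Solver)
  open import Data.Fin.Subset using (∣_∣; _∪_; ⁅_⁆)
  open +-*-Solver using (solve; _:+_; _:*_; _:=_; con)

  private variable
    A B : Set

  -- Finite sums and double counting

  ∑ : List A → (A → ℕ) → ℕ
  ∑ []       f = 0
  ∑ (x ∷ xs) f = f x + ∑ xs f

  ∑-mono : ∀ (xs : List A) {f g} → (∀ x → f x ≤ g x) → ∑ xs f ≤ ∑ xs g
  ∑-mono []       h = z≤n
  ∑-mono (x ∷ xs) h = +-mono-≤ (h x) (∑-mono xs h)

  ∑-cong : ∀ (xs : List A) {f g} → (∀ x → f x ≡ g x) → ∑ xs f ≡ ∑ xs g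
  ∑-cong []       h = refl
  ∑-cong (x ∷ xs) h = cong₂ _+_ (h x) (∑-cong xs h)

  ∑-+ : ∀ (xs : List A) f g → ∑ xs (λ x → f x + g x) ≡ ∑ xs f + ∑ xs g
  ∑-+ []       f g = refl
  ∑-+ (x ∷ xs) f g rewrite ∑-+ xs f g =
    solve 4 (λ a b c d → a :+ b :+ (c :+ d) := a :+ c :+ (b :+ d)) refl (f x) (g x) (∑ xs f) (∑ xs g)

  ∑-*ʳ : ∀ (xs : List A) f k → ∑ xs (λ x → f x * k) ≡ ∑ xs f * k
  ∑-*ʳ []       f k = refl
  ∑-*ʳ (x ∷ xs) f k rewrite ∑-*ʳ xs f k = sym (*-distribʳ-+ k (f x) (∑ xs f))

  ∑-*ˡ : ∀ (xs : List A) f k → ∑ xs (λ x → k * f x) ≡ k * ∑ xs f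
  ∑-*ˡ xs f k = trans (∑-cong xs (λ x → *-comm k (f x))) (trans (∑-*ʳ xs f k) (*-comm (∑ xs f) k))

  ∑-const : ∀ (xs : List A) k → ∑ xs (λ _ → k) ≡ length xs * k
  ∑-const []       k = refl
  ∑-const (x ∷ xs) k = cong (k +_) (∑-const xs k)

  ∑-swap : ∀ (xs : List A) (ys : List B) (f : A → B → ℕ) → ∑ xs (λ x → ∑ ys (f x)) ≡ ∑ ys (λ y → ∑ xs (λ x → f x y))
  ∑-swap []       ys f = sym (trans (∑-const ys 0) (*-zeroʳ (length ys)))
  ∑-swap (x ∷ xs) ys f rewrite ∑-swap xs ys f = sym (∑-+ ys (f x) _)

  ∑≡0⇒≡0 : ∀ {xs : List A} {f x} → ∑ xs f ≡ 0 → x ∈ xs → f x ≡ 0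
  ∑≡0⇒≡0 {xs = x ∷ _} {f} h (here refl) = m+n≡0⇒m≡0 (f x) h
  ∑≡0⇒≡0 {xs = x ∷ _} {f} h (there i)   = ∑≡0⇒≡0 (m+n≡0⇒n≡0 (f x) h) i

  𝟙 : {X : Set} → Dec X → ℕ
  𝟙 (yes _) = 1
  𝟙 (no _) = 0

  length-filter-∑ : {P : A → Set} (P? : Decidable P) (xs : List A) → length (filter P? xs) ≡ ∑ xs (λ x → 𝟙 (P? x))
  length-filter-∑ P? [] = refl
  length-filter-∑ P? (x ∷ xs) with P? x
  ... | yes _ = cong suc (length-filter-∑ P? xs)
  ... | no _  = length-filter-∑ P? xs

  double-count : {R : A → B → Set} (R? : ∀ a b → Dec (R a b)) (xs : List A) (ys : List B) →
    ∑ xs (λ a → length (filter (R? a) ys)) ≡ ∑ ys (λ b → length (filter (λ a → R? a b) xs))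
  double-count R? xs ys = begin
    ∑ xs (λ a → length (filter (R? a) ys))         ≡⟨ ∑-cong xs (λ a → length-filter-∑ (R? a) ys) ⟩
    ∑ xs (λ a → ∑ ys (λ b → 𝟙 (R? a b)))           ≡⟨ ∑-swap xs ys _ ⟩
    ∑ ys (λ b → ∑ xs (λ a → 𝟙 (R? a b)))           ≡⟨ ∑-cong ys (λ b → sym (length-filter-∑ (λ a → R? a b) xs)) ⟩
    ∑ ys (λ b → length (filter (λ a → R? a b) xs)) ∎
    where open ≡-Reasoning

  ∑-max : ∀ (x : A) xs f → ∃[ y ] ∑ (x ∷ xs) f ≤ length (x ∷ xs) * f y
  ∑-max x []        f = x , ≤-refl
  ∑-max x (x′ ∷ xs) f with ∑-max x′ xs f
  ... | y , h with ≤-total (f x) (f y)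
  ...   | inj₁ x≤y = y , +-mono-≤ x≤y h
  ...   | inj₂ y≤x = x , +-monoʳ-≤ (f x) (≤-trans h (*-monoʳ-≤ (suc (length xs)) y≤x))

  AllPairs-resp-⊆ : ∀ {R : A → A → Set} {xs ys} → xs ⊆ ys → AllPairs R ys → AllPairs R xs
  AllPairs-resp-⊆ []         []       = []
  AllPairs-resp-⊆ (_ ∷ʳ s)   (_ ∷ ps) = AllPairs-resp-⊆ s ps
  AllPairs-resp-⊆ (refl ∷ s) (p ∷ ps) = All-resp-⊆ s p ∷ AllPairs-resp-⊆ s ps

  -- Pigeonhole principle and averaging

  module Pigeonhole (_≟B_ : DecidableEquality B) (b₀ : B) (bs : List B) (complete : ∀ b → b ∈ b₀ ∷ bs) where

    ∣B∣ : ℕ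
    ∣B∣ = length (b₀ ∷ bs)

    pigeonhole : (f : A → B) (xs : List A) → ∃[ b ] length xs ≤ ∣B∣ * length (filter (λ x → f x ≟B b) xs)
    pigeonhole f xs with ∑-max b₀ bs (λ b → length (filter (λ x → f x ≟B b) xs))
    ... | b , h = b , ≤-trans (begin
      length xs
        ≡⟨ sym (trans (∑-const xs 1) (*-identityʳ _)) ⟩
      ∑ xs (λ _ → 1)
        ≤⟨ ∑-mono xs (λ x → hit (complete (f x))) ⟩
      ∑ xs (λ x → length (filter (f x ≟B_) (b₀ ∷ bs)))
        ≡⟨ double-count (λ x b → f x ≟B b) xs (b₀ ∷ bs) ⟩
      ∑ (b₀ ∷ bs) (λ b → length (filter (λ x → f x ≟B b) xs)) ∎) h
      where
      open ≤-Reasoning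
      hit : ∀ {b cs} → b ∈ cs → 1 ≤ length (filter (b ≟B_) cs)
      hit {b} {c ∷ cs} i with b ≟B c
      ... | yes _ = s≤s z≤n
      hit (here b≡c) | no b≢c = contradiction b≡c b≢c
      hit (there i)  | no _   = hit i

    -- One pigeonhole step per function, each at the cost of a factor `∣B∣`. Treating the functions
    -- one by one avoids an enumeration of all patterns.
    refine : (fs : List (A → B)) (xs : List A) → ∃[ ys ] (ys ⊆ xs × length xs ≤ ∣B∣ ^ length fs * length ys ×
      All (λ f → ∀ {x y} → x ∈ ys → y ∈ ys → f x ≡ f y) fs)
    refine []       xs = xs , ⊆-refl , ≤-reflexive (sym (+-identityʳ _)) , []
    refine (f ∷ fs) xs with pigeonhole f xs
    ... | b , xs≤ with refine fs (filter (λ x → f x ≟B b) xs)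
    ...   | ys , ys⊆ , ≤ys , const =
      ys , ⊆-trans ys⊆ (filter-⊆ _ xs) ,
      ≤-trans xs≤ (≤-trans (*-monoʳ-≤ ∣B∣ ≤ys) (≤-reflexive (sym (*-assoc ∣B∣ (∣B∣ ^ length fs) (length ys))))) ,
      (λ i j → trans (All.lookup value i) (sym (All.lookup value j))) ∷ const
      where
      value : All (λ x → f x ≡ b) ys
      value = All-resp-⊆ ys⊆ (All.all-filter (λ x → f x ≟B b) xs)

  -- The members of ys that are related to at least half the average number |xs|/M of members of xs.
  popular : {R : A → B → Set} (R? : ∀ a b → Dec (R a b)) (M : ℕ) (xs : List A) (ys : List B) .{{_ : NonZero (length xs)}} →
    All (λ a → length ys ≤ M * length (filter (R? a) ys)) xs →
    length ys ≤ 2 * M * length (filter (λ b → length xs ≤? 2 * M * length (filter (λ a → R? a b) xs)) ys)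
  popular {R = R} R? M xs ys h = *-cancelˡ-≤ m (+-cancelʳ-≤ (n * m) _ _ (begin
    m * n + n * m
      ≡⟨ solve 2 (λ m n → m :* n :+ n :* m := con 2 :* (m :* n)) refl m n ⟩
    2 * (m * n)
      ≤⟨ *-monoʳ-≤ 2 (≤-trans (mean xs h) (≤-reflexive (cong (M *_) (double-count R? xs ys)))) ⟩
    2 * (M * ∑ ys d)
      ≡⟨ trans (sym (*-assoc 2 M _)) (sym (∑-*ˡ ys d (2 * M))) ⟩
    ∑ ys (λ b → 2 * M * d b)
      -- An unpopular b contributes at most m, a popular one at most 2 M m. The sum is at least 2 m
      -- n, so the unpopular ones make up at most half of it.
      ≤⟨ ∑-mono ys each ⟩
    ∑ ys (λ b → 𝟙 (m ≤? 2 * M * d b) * (2 * M * m) + m)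
      ≡⟨ trans (∑-+ ys _ _) (cong₂ _+_ (∑-*ʳ ys _ (2 * M * m)) (∑-const ys m)) ⟩
    ∑ ys (λ b → 𝟙 (m ≤? 2 * M * d b)) * (2 * M * m) + n * m
      ≡⟨ cong (λ z → z * (2 * M * m) + n * m) (sym (length-filter-∑ (λ b → m ≤? 2 * M * d b) ys)) ⟩
    g * (2 * M * m) + n * m
      ≡⟨ cong (_+ n * m) (solve 3 (λ g M m → g :* (M :* m) := m :* (M :* g)) refl g (2 * M) m) ⟩
    m * (2 * M * g) + n * m ∎))
    where
    open ≤-Reasoning
    m n g : ℕ
    m = length xs
    n = length ys
    d : _ → ℕ
    d b = length (filter (λ a → R? a b) xs)
    g = length (filter (λ b → m ≤? 2 * M * d b) ys)
    mean : ∀ as → All (λ a → n ≤ M * length (filter (R? a) ys)) as → length as * n ≤ M * ∑ as (λ a → length (filter (R? a) ys))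
    mean []       []       = z≤n
    mean (a ∷ as) (p ∷ ps) = ≤-trans (+-mono-≤ p (mean as ps)) (≤-reflexive (sym (*-distribˡ-+ M _ _)))
    each : ∀ b → 2 * M * d b ≤ 𝟙 (m ≤? 2 * M * d b) * (2 * M * m) + m
    each b with m ≤? 2 * M * d b
    ... | no m≰  = <⇒≤ (≰⇒> m≰)
    ... | yes _  = ≤-trans (*-monoʳ-≤ (2 * M) (length-filter (λ a → R? a b) xs))
      (≤-trans (≤-reflexive (sym (+-identityʳ _))) (m≤m+n _ m))

  -- Degrees and the estimator of missing colours

  bit : Bool → ℕ
  bit b = if b then 1 else 0

  ∣tabulate∣ : ∀ {n} {A : Set} (g : Fin n → A) (f : A → Bool) → ∣ Vec.tabulate (f ∘ g) ∣ ≡ ∑ (List.tabulate g) (bit ∘ f)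
  ∣tabulate∣ {zero}  g f = refl
  ∣tabulate∣ {suc n} g f with f (g zero)
  ... | true  = cong suc (∣tabulate∣ (g ∘ suc) f)
  ... | false = ∣tabulate∣ (g ∘ suc) f

  length-allFin : ∀ n → length (allFin n) ≡ n
  length-allFin n = length-tabulate id

  module Estimator {r n : ℕ} (G : ColouredGraph r n) where

    _≟c_ : (x y : Maybe (Fin r)) → Dec (x ≡ y)
    _≟c_ = Maybe.≡-dec Fin._≟_

    hits : Fin n → Fin r → Fin n → Bool
    hits u c v = does (colour G u v ≟c just c)

    off : Fin n → Fin r → Fin n → ℕ
    off u c v = if hits u c v then 0 else 1

    ∑-off : ∀ u c → ∑ (allFin n) (off u c) + degree G c u ≡ n
    ∑-off u c = begin
      ∑ (allFin n) (off u c) + degree G c u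
        ≡⟨ cong (∑ (allFin n) (off u c) +_) (∣tabulate∣ id (hits u c)) ⟩
      ∑ (allFin n) (off u c) + ∑ (allFin n) (bit ∘ hits u c)
        ≡⟨ sym (∑-+ (allFin n) (off u c) (bit ∘ hits u c)) ⟩
      ∑ (allFin n) (λ v → off u c v + bit (hits u c v))
        ≡⟨ ∑-cong (allFin n) (λ v → one (hits u c v)) ⟩
      ∑ (allFin n) (λ _ → 1)
        ≡⟨ trans (∑-const (allFin n) 1) (trans (*-identityʳ _) (length-allFin n)) ⟩
      n ∎
      where
      open ≡-Reasoning
      one : ∀ b → (if b then 0 else 1) + bit b ≡ 1
      one true  = refl
      one false = refl

    -- The colour classes at `u` are disjoint. With all degrees at least n/D this will give r ≤ D,
    -- and with two colours y ≤ 1/2 for the lower approximation y of ε.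
    ∑-degree : ∀ u → ∑ (allFin r) (λ c → degree G c u) ≤ n
    ∑-degree u = begin
      ∑ (allFin r) (λ c → degree G c u)
        ≡⟨ ∑-cong (allFin r) (λ c → ∣tabulate∣ id (hits u c)) ⟩
      ∑ (allFin r) (λ c → ∑ (allFin n) (bit ∘ hits u c))
        ≡⟨ ∑-swap (allFin r) (allFin n) (λ c v → bit (hits u c v)) ⟩
      ∑ (allFin n) (λ v → ∑ (allFin r) (λ c → bit (hits u c v)))
        ≤⟨ ∑-mono (allFin n) (λ v → ≤-trans (≤-reflexive (sym (∣tabulate∣ id (λ c → hits u c v)))) (one (colour G u v))) ⟩
      ∑ (allFin n) (λ _ → 1)
        ≡⟨ trans (∑-const (allFin n) 1) (trans (*-identityʳ _) (length-allFin n)) ⟩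
      n ∎
      where
      open ≤-Reasoning
      one : ∀ x → ∣ Vec.tabulate (λ c → does (x ≟c just c)) ∣ ≤ 1
      one x = ≤-trans (≤-reflexive (∣tabulate∣ id (λ c → does (x ≟c just c)))) (at-most (allFin r) (Unique.allFin⁺ r))
        where
        none : ∀ cs → All (λ c → x ≢ just c) cs → ∑ cs (λ c → bit (does (x ≟c just c))) ≡ 0
        none []       []       = refl
        none (c ∷ cs) (p ∷ ps) with x ≟c just c
        ... | yes q = contradiction q p
        ... | no _  = none cs ps
        at-most : ∀ cs → Unique cs → ∑ cs (λ c → bit (does (x ≟c just c))) ≤ 1
        at-most []       []       = z≤n
        at-most (c ∷ cs) (p ∷ ps) with x ≟c just c
        ... | yes q = ≤-reflexive (cong suc (none cs (All.map (λ c≢ q′ → c≢ (Maybe.just-injective (trans (sym q) q′))) p)))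
        ... | no _  = at-most cs ps

    -- 1 if u has no neighbour of colour c in xs, else 0.
    miss : ∀ {j} → Fin n → Fin r → Vec (Fin n) j → ℕ
    miss u c []       = 1
    miss u c (v ∷ xs) = off u c v * miss u c xs

    miss≡0 : ∀ {j} u c (xs : Vec (Fin n) j) → miss u c xs ≡ 0 → ∃[ i ] colour G u (lookup xs i) ≡ just c
    miss≡0 u c (v ∷ xs) h with colour G u v ≟c just c
    ... | yes e = zero , e
    ... | no _  with miss≡0 u c xs (trans (sym (+-identityʳ _)) h)
    ...   | i , e = suc i , e

    -- The tested vertices `us` are kept apart from `xs` because the estimator counts both for the
    -- entries of `xs` and for all vertices, the candidates for further entries.
    missing : ∀ {j} → List (Fin n) → Vec (Fin n) j → ℕ
    missing us xs = ∑ us (λ u → ∑ (allFin r) (λ c → miss u c xs))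

    missing-nonincreasing : ∀ {j} us v (xs : Vec (Fin n) j) → missing us (v ∷ xs) ≤ missing us xs
    missing-nonincreasing us v xs = ∑-mono us λ u → ∑-mono (allFin r) λ c →
      ≤-trans (*-monoˡ-≤ (miss u c xs) (off≤1 (hits u c v))) (≤-reflexive (+-identityʳ _))
      where
      off≤1 : ∀ b → (if b then 0 else 1) ≤ 1
      off≤1 true  = z≤n
      off≤1 false = ≤-refl

    module _ (q : ℕ) (off≤q : ∀ u c → ∑ (allFin n) (off u c) ≤ q) where

      -- A missing pair (u , c) survives the choice of v only if v is not a c-neighbour of u, which
      -- leaves at most q choices.
      ∑-missing : ∀ {j} us (xs : Vec (Fin n) j) → ∑ (allFin n) (λ v → missing us (v ∷ xs)) ≤ q * missing us xs
      ∑-missing us xs = begin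
        ∑ (allFin n) (λ v → missing us (v ∷ xs))
          ≡⟨ ∑-swap (allFin n) us _ ⟩
        ∑ us (λ u → ∑ (allFin n) (λ v → ∑ (allFin r) (λ c → off u c v * miss u c xs)))
          ≡⟨ ∑-cong us (λ u → ∑-swap (allFin n) (allFin r) _) ⟩
        ∑ us (λ u → ∑ (allFin r) (λ c → ∑ (allFin n) (λ v → off u c v * miss u c xs)))
          ≤⟨ ∑-mono us (λ u → ∑-mono (allFin r) (λ c → ≤-trans
               (≤-reflexive (∑-*ʳ (allFin n) (off u c) (miss u c xs))) (*-monoˡ-≤ (miss u c xs) (off≤q u c)))) ⟩
        ∑ us (λ u → ∑ (allFin r) (λ c → q * miss u c xs))
          ≡⟨ trans (∑-cong us (λ u → ∑-*ˡ (allFin r) _ q)) (∑-*ˡ us _ q) ⟩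
        q * missing us xs ∎
        where open ≤-Reasoning

      -- This is i q^(i-1): any of the i random entries may be the one lacking a colour, and then
      -- each of the other i - 1 has at most q choices. The recursive form is the one that the
      -- supermartingale property produces.
      w : ℕ → ℕ
      w zero    = 0
      w (suc i) = q * w i + q ^ i

      w-closed : ∀ i → w (suc i) ≡ suc i * q ^ i
      w-closed zero    = cong (_+ 1) (*-zeroʳ q)
      w-closed (suc i) rewrite w-closed i =
        solve 3 (λ q i p → q :* (p :+ i :* p) :+ q :* p := q :* p :+ (q :* p :+ i :* (q :* p))) refl q i (q ^ i)

      -- nⁱ times an upper bound for the expected number of pairs (x , c) with x among the entries of
      -- ys ++ xs having no neighbour of colour c there, where ys is a uniformly random i-tuple.
      U : ∀ {j} → ℕ → Vec (Fin n) j → ℕ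
      U i xs = missing (toList xs) xs * q ^ i + missing (allFin n) xs * w i

      -- By `∑-missing`, both counts grow by a factor of at most q when summed over `v`. In
      -- addition, the new entry `v` brings its own missing pairs, over all `v` at most
      -- `missing V xs`; this is the summand q^i in `w`.
      U-supermartingale : ∀ {j} i (xs : Vec (Fin n) j) → ∑ (allFin n) (λ v → U i (v ∷ xs)) ≤ U (suc i) xs
      U-supermartingale i xs = begin
        ∑ V (λ v → missing (toList (v ∷ xs)) (v ∷ xs) * q ^ i + missing V (v ∷ xs) * w i)
          ≡⟨ trans (∑-+ V _ _) (cong₂ _+_ (∑-*ʳ V _ (q ^ i)) (∑-*ʳ V _ (w i))) ⟩
        ∑ V (λ v → missing (toList (v ∷ xs)) (v ∷ xs)) * q ^ i + ∑ V (λ v → missing V (v ∷ xs)) * w i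
          ≤⟨ +-mono-≤ (*-monoˡ-≤ (q ^ i) new) (*-monoˡ-≤ (w i) (∑-missing V xs)) ⟩
        (f + q * m) * q ^ i + q * f * w i
          ≡⟨ solve 5 (λ f q m p w → (f :+ q :* m) :* p :+ q :* f :* w := m :* (q :* p) :+ f :* (q :* w :+ p))
               refl f q m (q ^ i) (w i) ⟩
        U (suc i) xs ∎
        where
        open ≤-Reasoning
        V : List (Fin n)
        V = allFin n
        f m : ℕ
        f = missing V xs
        m = missing (toList xs) xs
        new : ∑ V (λ v → missing (toList (v ∷ xs)) (v ∷ xs)) ≤ f + q * m
        new = begin
          ∑ V (λ v → ∑ (allFin r) (λ c → miss v c (v ∷ xs)) + missing (toList xs) (v ∷ xs))
            ≡⟨ ∑-+ V _ _ ⟩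
          ∑ V (λ v → ∑ (allFin r) (λ c → miss v c (v ∷ xs))) + ∑ V (λ v → missing (toList xs) (v ∷ xs))
            ≤⟨ +-mono-≤
                 (∑-mono V (λ v → subst₂ _≤_ (+-identityʳ _) (+-identityʳ _) (missing-nonincreasing (v ∷ []) v xs)))
                 (∑-missing (toList xs) xs) ⟩
          f + q * m ∎

      module _ (M′ : ℕ) where

        M : ℕ
        M = suc M′

        -- After division by (n M)^i: the estimate is below (1 - 1/M)^i. The threshold rises by the
        -- factor M/M′ with each vertex chosen, which is the slack that makes a proportion 1/M of
        -- the extensions rich.
        record Rich {j : ℕ} (i : ℕ) (xs : Vec (Fin n) j) : Set where
          constructor mkRich
          field
            U-small : U i xs * M ^ i < (n * M′) ^ i

        Rich? : ∀ {j} i (xs : Vec (Fin n) j) → Dec (Rich i xs)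
        Rich? i xs = map′ mkRich Rich.U-small (U i xs * M ^ i <? (n * M′) ^ i)

        -- Markov's inequality: were fewer than n/M extensions rich, at least n M′/M of them would
        -- reach the threshold for i, and their sum would contradict `U-supermartingale`.
        rich-extensions : ∀ {j} i (xs : Vec (Fin n) j) → Rich (suc i) xs →
          n ≤ M * length (filter (λ v → Rich? i (v ∷ xs)) (allFin n))
        rich-extensions i xs (mkRich rich) = ≮⇒≥ λ few → n≮n (n * M′ * τ) (begin-strict
          n * M′ * τ
            ≤⟨ *-monoˡ-≤ τ (+-cancelʳ-≤ (suc (M * g)) _ _ (begin
                 n * M′ + suc (M * g) ≤⟨ +-monoʳ-≤ (n * M′) few ⟩
                 n * M′ + n           ≡⟨ solve 2 (λ n m → n :* m :+ n := (con 1 :+ m) :* n) refl n M′ ⟩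
                 M * n                ≤⟨ *-monoʳ-≤ M (≤-reflexive (sym poor+rich)) ⟩
                 M * (b + g)          ≤⟨ ≤-trans (≤-reflexive (*-distribˡ-+ M b g)) (+-monoʳ-≤ (M * b) (n≤1+n (M * g))) ⟩
                 M * b + suc (M * g) ∎)) ⟩
          M * b * τ
            ≡⟨ *-assoc M b τ ⟩
          M * (b * τ)
            ≤⟨ *-monoʳ-≤ M (begin
                 b * τ                                    ≡⟨ sym (∑-*ʳ V poor τ) ⟩
                 ∑ V (λ v → poor v * τ)                   ≤⟨ ∑-mono V markov ⟩
                 ∑ V (λ v → U i (v ∷ xs) * M ^ i)         ≡⟨ ∑-*ʳ V _ (M ^ i) ⟩
                 ∑ V (λ v → U i (v ∷ xs)) * M ^ i         ≤⟨ *-monoˡ-≤ (M ^ i) (U-supermartingale i xs) ⟩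
                 U (suc i) xs * M ^ i ∎) ⟩
          M * (U (suc i) xs * M ^ i)
            ≡⟨ solve 3 (λ m u p → m :* (u :* p) := u :* (m :* p)) refl M (U (suc i) xs) (M ^ i) ⟩
          U (suc i) xs * M ^ suc i
            <⟨ rich ⟩
          n * M′ * τ ∎)
          where
          open ≤-Reasoning
          V : List (Fin n)
          V = allFin n
          τ g b : ℕ
          τ = (n * M′) ^ i
          g = length (filter (λ v → Rich? i (v ∷ xs)) V)
          poor : Fin n → ℕ
          poor v = 1 ∸ 𝟙 (Rich? i (v ∷ xs))
          b = ∑ V poor
          poor+rich : b + g ≡ n
          poor+rich = begin-equality
            b + g
              ≡⟨ cong (b +_) (length-filter-∑ (λ v → Rich? i (v ∷ xs)) V) ⟩
            b + ∑ V (λ v → 𝟙 (Rich? i (v ∷ xs)))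
              ≡⟨ sym (∑-+ V _ _) ⟩
            ∑ V (λ v → poor v + 𝟙 (Rich? i (v ∷ xs)))
              ≡⟨ ∑-cong V (λ v → one (Rich? i (v ∷ xs))) ⟩
            ∑ V (λ _ → 1)
              ≡⟨ trans (∑-const V 1) (trans (*-identityʳ _) (length-allFin n)) ⟩
            n ∎
            where
            one : ∀ {X : Set} (d : Dec X) → 1 ∸ 𝟙 d + 𝟙 d ≡ 1
            one (yes _) = refl
            one (no _)  = refl
          markov : ∀ v → poor v * τ ≤ U i (v ∷ xs) * M ^ i
          markov v with Rich? i (v ∷ xs)
          ... | yes _ = z≤n
          ... | no ¬p = ≤-trans (≤-reflexive (+-identityʳ τ)) (≮⇒≥ (¬p ∘ mkRich))

        -- With no vertex left to choose the threshold is 1, and a natural number below 1 is 0.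
        rich⇒unibalanced : ∀ {j} (xs : Vec (Fin n) j) → Rich 0 xs →
          ∀ i c → ∃[ i′ ] colour G (lookup xs i) (lookup xs i′) ≡ just c
        rich⇒unibalanced xs (mkRich rich) i c = miss≡0 (lookup xs i) c xs
          (∑≡0⇒≡0 (∑≡0⇒≡0 {xs = toList xs} missing≡0 (member xs i)) (∈-allFin c))
          where
          missing≡0 : missing (toList xs) xs ≡ 0
          missing≡0 = m*n≡0⇒m≡0 _ 1 (m+n≡0⇒m≡0 _ (m*n≡0⇒m≡0 _ 1 (n<1⇒n≡0 rich)))
          member : ∀ {j} (ys : Vec (Fin n) j) i → lookup ys i ∈ toList ys
          member (y ∷ ys) zero    = here refl
          member (y ∷ ys) (suc i) = there (member ys i)

        -- The empty tuple has no entries to test and hits nothing, so all n r pairs are missing and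
        -- only the summand with `w` remains.
        rich-[] : ∀ i → suc i * r * (n * q ^ i) * M ^ suc i < (n * M′) ^ suc i → Rich (suc i) []
        rich-[] i h = mkRich (≤-<-trans (*-monoˡ-≤ (M ^ suc i) (≤-reflexive (begin
          missing (allFin n) [] * w (suc i)
            ≡⟨ cong₂ _*_ (trans (∑-const (allFin n) _) (cong₂ _*_ (length-allFin n)
                 (trans (∑-const (allFin r) 1) (trans (*-identityʳ _) (length-allFin r))))) (w-closed i) ⟩
          n * r * (suc i * q ^ i)
            ≡⟨ solve 4 (λ n r k p → n :* r :* (k :* p) := k :* r :* (n :* p)) refl n r (suc i) (q ^ i) ⟩
          suc i * r * (n * q ^ i) ∎))) h)
          where open ≡-Reasoning

  -- Ramsey's theorem for several colours

  module Ramsey {r n : ℕ} (G : ColouredGraph (suc r) n) (complete : Complete G) where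

    -- Each vertex of the chain sends only edges of its own colour to the later ones.
    Chain : List (Fin n × Fin (suc r)) → Set
    Chain = AllPairs λ (v , c) (w , _) → colour G v w ≡ just c

    open Pigeonhole (Fin._≟_ {suc r}) zero (List.tabulate suc) ∈-allFin

    -- Keep the first vertex and pass to its largest colour class among the others. The base is one
    -- more than the number r + 1 of colours to pay for the vertex kept: (r+2)^(t+1) ≥ 1 +
    -- (r+1)(r+2)^t.
    chain : ∀ t vs → Unique vs → suc (suc r) ^ t ≤ length vs →
      ∃[ zs ] (length zs ≡ t × All (λ z → proj₁ z ∈ vs) zs × Chain zs)
    chain zero    vs       u        h = [] , refl , [] , []
    chain (suc t) []       u        h = contradiction h (<⇒≱ (m^n>0 (suc (suc r)) (suc t)))
    -- `fromMaybe zero` only makes the colour total: `G` is complete and `v` differs from all of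
    -- `vs`, so `coloured` can recover the actual colour.
    chain (suc t) (v ∷ vs) (v∉ ∷ u) h with pigeonhole (λ w → fromMaybe zero (colour G v w)) vs
    ... | c , vs≤ with chain t (filter (λ w → fromMaybe zero (colour G v w) Fin.≟ c) vs)
                      (AllPairs.filter⁺ (λ w → fromMaybe zero (colour G v w) Fin.≟ c) u) big
      where
      big : suc (suc r) ^ t ≤ length (filter (λ w → fromMaybe zero (colour G v w) Fin.≟ c) vs)
      big = *-cancelˡ-≤ (suc r) (≤-trans
        (+-cancelˡ-≤ 1 _ _ (≤-trans (+-monoˡ-≤ (suc r * suc (suc r) ^ t) (m^n>0 (suc (suc r)) t)) h))
        (subst (λ p → length vs ≤ p * length (filter (λ w → fromMaybe zero (colour G v w) Fin.≟ c) vs)) (length-allFin (suc r)) vs≤))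
    ... | zs , len , zs∈ , ps = (v , c) ∷ zs , cong suc len ,
      here refl ∷ All.map (λ i → there (mem i)) zs∈ ,
      All.map (λ i → coloured (All.lookup v∉ (mem i)) (val i)) zs∈ ∷ ps
      where
      f : Fin n → Fin (suc r)
      f w = fromMaybe zero (colour G v w)
      mem : ∀ {w} → w ∈ filter (λ w → f w Fin.≟ c) vs → w ∈ vs
      mem i = proj₁ (∈-filter⁻ (λ w → f w Fin.≟ c) i)
      val : ∀ {w} → w ∈ filter (λ w → f w Fin.≟ c) vs → f w ≡ c
      val i = proj₂ (∈-filter⁻ (λ w → f w Fin.≟ c) {xs = vs} i)
      coloured : ∀ {w} → v ≢ w → f w ≡ c → colour G v w ≡ just c
      coloured {w} v≢w e with colour G v w | complete v w v≢w
      ... | just _ | _ , refl = cong just e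

    -- Among (r+1) s chain vertices some s have the same own colour, and by the chain property all
    -- edges between these have that colour.
    monochromatic-clique : ∀ s vs → Unique vs → suc (suc r) ^ (suc r * s) ≤ length vs →
      ∃[ ws ] ∃[ c ] (s ≤ length ws × All (_∈ vs) ws × AllPairs (λ v w → colour G v w ≡ just c) ws)
    monochromatic-clique s vs u h with chain (suc r * s) vs u h
    ... | zs , len , zs∈ , ps with pigeonhole proj₂ zs
    ...   | c , zs≤ = map proj₁ zs′ , c ,
      subst (s ≤_) (sym (length-map proj₁ zs′)) (*-cancelˡ-≤ (suc r) (subst₂ (λ l p → l ≤ p * length zs′) len (length-allFin (suc r)) zs≤)) ,
      All.map⁺ (All.filter⁺ P? zs∈) ,
      AllPairs.map⁺ (pairs (All.all-filter P? zs) (AllPairs.filter⁺ P? ps))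
      where
      P? : ∀ z → Dec (proj₂ z ≡ c)
      P? z = proj₂ z Fin.≟ c
      zs′ : List (Fin n × Fin (suc r))
      zs′ = filter P? zs
      pairs : ∀ {ys} → All (λ z → proj₂ z ≡ c) ys → Chain ys → AllPairs (λ y z → colour G (proj₁ y) (proj₁ z) ≡ just c) ys
      pairs []       []       = []
      pairs (refl ∷ es) (p ∷ ps) = p ∷ pairs es ps

  -- Grids and the climb through rich tuples

  does-transfer : ∀ {X Y : Set} (d : Dec X) (e : Dec Y) → does d ≡ does e → X → Y
  does-transfer d       (yes y) eq x = y
  does-transfer (no ¬x) (no _)  eq x = contradiction x ¬x

  length-cartesianProductWith : ∀ {A B C : Set} (f : A → B → C) xs ys →
    length (cartesianProductWith f xs ys) ≡ length xs * length ys
  length-cartesianProductWith f []       ys = refl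
  length-cartesianProductWith f (x ∷ xs) ys = trans (length-++ (map (f x) ys))
    (cong₂ _+_ (length-map (f x) ys) (length-cartesianProductWith f xs ys))

  universal : ∀ {A : Set} {R : A → A → Set} → (∀ x y → R x y) → ∀ xs → AllPairs R xs
  universal r []       = []
  universal r (x ∷ xs) = All.tabulate (λ {y} _ → r x y) ∷ universal r xs

  module _ {A : Set} {j : ℕ} where

    All-zip : ∀ {P : A → Set} {Q : Vec A j → Set} {xs yss} → All P xs → All Q yss →
      All (λ z → P (Vec.head z) × Q (Vec.tail z)) (zipWith _∷_ xs yss)
    All-zip []       _        = []
    All-zip (_ ∷ _)  []       = []
    All-zip (p ∷ ps) (q ∷ qs) = (p , q) ∷ All-zip ps qs

    AllPairs-zip : ∀ {R : A → A → Set} {T : Vec A j → Vec A j → Set} {xs yss} → AllPairs R xs → AllPairs T yss →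
      AllPairs (λ z z′ → R (Vec.head z) (Vec.head z′) × T (Vec.tail z) (Vec.tail z′)) (zipWith _∷_ xs yss)
    AllPairs-zip []       _        = []
    AllPairs-zip (_ ∷ _)  []       = []
    AllPairs-zip (p ∷ ps) (q ∷ qs) = All-zip p q ∷ AllPairs-zip ps qs

    ∈-zip : ∀ {xs : List A} {yss : List (Vec A j)} {z zs} → (z ∷ zs) ∈ zipWith _∷_ xs yss → z ∈ xs × zs ∈ yss
    ∈-zip {xs} {yss} i = All.lookup (All-zip {xs = xs} (All.tabulate id) (All.tabulate {xs = yss} id)) i

  -- A row holds one vertex of each part; the i-th part consists of the i-th entries of all rows.
  record Grid {r n j : ℕ} (G : ColouredGraph r n) (rows : List (Vec (Fin n) j)) : Set where
    field
      clique      : ∀ i → ∃[ c ] AllPairs (λ x y → colour G (lookup x i) (lookup y i) ≡ just c) rows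
      homogeneous : ∀ i i′ → i ≢ i′ → ∀ {x y x′ y′} → x ∈ rows → y ∈ rows → x′ ∈ rows → y′ ∈ rows →
                    colour G (lookup x i) (lookup y i′) ≡ colour G (lookup x′ i) (lookup y′ i′)

  module Construction {r n : ℕ} (G : ColouredGraph (suc r) n) (complete : Complete G)
    (q : ℕ) (off≤q : ∀ u c → ∑ (allFin n) (Estimator.off G u c) ≤ q) (M′ K : ℕ) where

    open Estimator G
    open Ramsey G complete using (monochromatic-clique)

    ∈-bools : ∀ b → b ∈ false ∷ true ∷ []
    ∈-bools false = here refl
    ∈-bools true  = there (here refl)

    palette : List (Maybe (Fin (suc r)))
    palette = map just (allFin (suc r))

    ∈-palette : ∀ x → x ∈ nothing ∷ palette
    ∈-palette nothing  = here refl
    ∈-palette (just c) = there (∈-map⁺ just (∈-allFin c))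

    module Bools   = Pigeonhole Bool._≟_ false (true ∷ []) ∈-bools
    module Colours = Pigeonhole _≟c_ nothing palette ∈-palette

    Rich′ : ∀ {j} → ℕ → Vec (Fin n) j → Set
    Rich′ = Rich q off≤q M′

    rich? : ∀ {j} i (xs : Vec (Fin n) j) → Dec (Rich′ i xs)
    rich? = Rich? q off≤q M′

    -- `p` is the number of values of `colour`: r + 1 colours and `nothing`. `shrink` is the loss of
    -- rows in one step: 2 M⁺ for keeping the rows that a popular vertex extends richly, p^K for
    -- making its colours towards each column constant.
    M⁺ p shrink : ℕ
    M⁺ = suc M′
    p = suc (suc r)
    shrink = 2 * M⁺ * p ^ K

    shrink≢0 : NonZero shrink
    shrink≢0 = >-nonZero (*-mono-≤ {1} {2 * M⁺} (s≤s z≤n) (m^n>0 p K))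

    -- The factors pay, for m rows, for the restriction to popular vertices, the patterns of
    -- richness, the patterns of colours, and Ramsey's theorem.
    needed : ℕ → ℕ
    needed m = 2 * M⁺ * (2 ^ m * p ^ (m * K) * p ^ (suc r * m))

    ∣Colours∣ : Colours.∣B∣ ≡ p
    ∣Colours∣ = cong suc (trans (length-map just (allFin (suc r))) (length-allFin (suc r)))

    module _ {j : ℕ} (i : ℕ) (rows : List (Vec (Fin n) j)) where

      rich-rows : Fin n → List (Vec (Fin n) j)
      rich-rows v = filter (λ x → rich? i (v ∷ x)) rows

      popular? : ∀ v → Dec (length rows ≤ 2 * M⁺ * length (rich-rows v))
      popular? v = length rows ≤? 2 * M⁺ * length (rich-rows v)

      -- Nikiforov's trick: the rows are so few compared to n that many vertices behave in the same
      -- way towards all of them.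
      record Indistinguishable (W : List (Fin n)) : Set where
        field
          rich-same   : ∀ {x v v′} → x ∈ rows → v ∈ W → v′ ∈ W → does (rich? i (v ∷ x)) ≡ does (rich? i (v′ ∷ x))
          colour-same : ∀ {x v v′} k → x ∈ rows → v ∈ W → v′ ∈ W → colour G v (lookup x k) ≡ colour G v′ (lookup x k)

      indistinguishable : (vs : List (Fin n)) → ∃[ W ] (W ⊆ vs ×
        length vs ≤ 2 ^ length rows * p ^ (length rows * j) * length W × Indistinguishable W)
      indistinguishable vs with Bools.refine (map (λ x v → does (rich? i (v ∷ x))) rows) vs
      ... | W₁ , W₁⊆ , vs≤ , same₁ with Colours.refine (cartesianProductWith (λ x k v → colour G v (lookup x k)) rows (allFin j)) W₁
      ...   | W , W⊆ , W₁≤ , same₂ = W , ⊆-trans W⊆ W₁⊆ , bound , record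
        { rich-same   = λ x∈ v∈ v′∈ → All.lookup same₁ (∈-map⁺ (λ x v → does (rich? i (v ∷ x))) x∈)
            (∈-resp-⊆ W⊆ v∈) (∈-resp-⊆ W⊆ v′∈)
        ; colour-same = λ k x∈ → All.lookup same₂ (∈-cartesianProductWith⁺ (λ x k v → colour G v (lookup x k)) x∈ (∈-allFin k))
        }
        where
        open ≤-Reasoning
        m : ℕ
        m = length rows
        bound : length vs ≤ 2 ^ m * p ^ (m * j) * length W
        bound = begin
          length vs
            ≤⟨ subst (λ z → length vs ≤ 2 ^ z * length W₁) (length-map _ rows) vs≤ ⟩
          2 ^ m * length W₁
            ≤⟨ *-monoʳ-≤ (2 ^ m) (subst₂ (λ b z → length W₁ ≤ b ^ z * length W) ∣Colours∣
                 (trans (length-cartesianProductWith _ rows (allFin j)) (cong (m *_) (length-allFin j))) W₁≤) ⟩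
          2 ^ m * (p ^ (m * j) * length W)
            ≡⟨ sym (*-assoc (2 ^ m) _ _) ⟩
          2 ^ m * p ^ (m * j) * length W ∎

      -- Each rich row has at least n/M⁺ rich extensions, so by averaging at least n/(2 M⁺) vertices
      -- are popular; they are split into at most 2^m p^(m j) classes.
      popular-class : 1 ≤ length rows → j ≤ K → needed (length rows) ≤ n → All (Rich′ (suc i)) rows →
        ∃[ W ] (Unique W × p ^ (suc r * length rows) ≤ length W × Indistinguishable W ×
          All (λ v → length rows ≤ 2 * M⁺ * length (rich-rows v)) W)
      popular-class 1≤m j≤K n≥ rich with indistinguishable (filter popular? (allFin n))
      ... | W , W⊆ , L≤ , same = W , AllPairs-resp-⊆ (⊆-trans W⊆ (filter-⊆ popular? (allFin n))) (Unique.allFin⁺ n) ,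
        *-cancelˡ-≤ (2 ^ m * p ^ (m * K)) {{m*n≢0 (2 ^ m) (p ^ (m * K)) {{m^n≢0 2 m}} {{m^n≢0 p (m * K)}}}}
          (*-cancelˡ-≤ (2 * M⁺) (begin
            2 * M⁺ * (2 ^ m * p ^ (m * K) * p ^ (suc r * m))
              ≤⟨ n≥ ⟩
            n
              ≤⟨ subst (_≤ 2 * M⁺ * length (filter popular? (allFin n))) (length-allFin n)
                   (popular (λ x v → rich? i (v ∷ x)) M⁺ rows (allFin n) {{>-nonZero 1≤m}} (All.map extensions rich)) ⟩
            2 * M⁺ * length (filter popular? (allFin n))
              ≤⟨ *-monoʳ-≤ (2 * M⁺) (≤-trans L≤ (*-monoˡ-≤ (length W) (*-monoʳ-≤ (2 ^ m) (^-monoʳ-≤ p (*-monoʳ-≤ m j≤K))))) ⟩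
            2 * M⁺ * (2 ^ m * p ^ (m * K) * length W) ∎)) ,
        same , All-resp-⊆ W⊆ (All.all-filter popular? (allFin n))
        where
        open ≤-Reasoning
        m : ℕ
        m = length rows
        extensions : ∀ {x} → Rich′ (suc i) x → length (allFin n) ≤ M⁺ * length (filter (λ v → rich? i (v ∷ x)) (allFin n))
        extensions {x} ρ = subst (_≤ M⁺ * length (filter (λ v → rich? i (v ∷ x)) (allFin n))) (sym (length-allFin n))
          (rich-extensions q off≤q M′ i x ρ)

      -- Each of the j ≤ K columns costs a factor p. Selecting the rows for a single vertex
      -- suffices, since the other vertices of its class behave alike.
      similar-rows : ∀ w → j ≤ K → length rows ≤ 2 * M⁺ * length (rich-rows w) →
        ∃[ S ] (S ⊆ rows × length rows ≤ shrink * length S × All (λ x → Rich′ i (w ∷ x)) S ×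
          (∀ k {x x′} → x ∈ S → x′ ∈ S → colour G w (lookup x k) ≡ colour G w (lookup x′ k)))
      similar-rows w j≤K m≤ with Colours.refine (map (λ k x → colour G w (lookup x k)) (allFin j)) (rich-rows w)
      ... | S , S⊆ , S₁≤ , same = S , ⊆-trans S⊆ (filter-⊆ _ rows) , bound ,
        All-resp-⊆ S⊆ (All.all-filter (λ x → rich? i (w ∷ x)) rows) ,
        λ k → All.lookup same (∈-map⁺ (λ k x → colour G w (lookup x k)) (∈-allFin k))
        where
        open ≤-Reasoning
        bound : length rows ≤ shrink * length S
        bound = begin
          length rows
            ≤⟨ m≤ ⟩
          2 * M⁺ * length (rich-rows w)
            ≤⟨ *-monoʳ-≤ (2 * M⁺) (≤-trans
                 (subst₂ (λ b z → length (rich-rows w) ≤ b ^ z * length S) ∣Colours∣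
                   (trans (length-map _ (allFin j)) (length-allFin j)) S₁≤)
                 (*-monoˡ-≤ (length S) (^-monoʳ-≤ p j≤K))) ⟩
          2 * M⁺ * (p ^ K * length S)
            ≡⟨ sym (*-assoc (2 * M⁺) (p ^ K) (length S)) ⟩
          shrink * length S ∎

      -- The rows in `S` were selected for `w₀`, but every vertex of `W` sees them as `w₀` does.
      -- Hence clique vertices and rows may be paired in any way.
      join : ∀ s {W ws S w₀ c} → Indistinguishable W → w₀ ∈ W → S ⊆ rows →
        All (λ x → Rich′ i (w₀ ∷ x)) S → (∀ k {x x′} → x ∈ S → x′ ∈ S → colour G w₀ (lookup x k) ≡ colour G w₀ (lookup x′ k)) →
        All (_∈ W) ws → AllPairs (λ v w → colour G v w ≡ just c) ws → s ≤ length ws → s ≤ length S → Grid G rows →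
        ∃[ rows′ ] (length rows′ ≡ s × All (Rich′ {suc j} i) rows′ × Grid G rows′)
      join s {W} {ws} {S} {w₀} {c} ind w₀∈ S⊆ richS sameS ws∈ mono s≤ws s≤S grid =
        rows′ , len′ , rich′ , grid′
        where
        open Indistinguishable ind
        rows′ : List (Vec (Fin n) (suc j))
        -- Both lists may be longer than s; `take` together with the truncation in `zipWith` gives
        -- exactly s rows.
        rows′ = zipWith _∷_ ws (take s S)
        len′ : length rows′ ≡ s
        len′ = trans (length-zipWith _∷_ ws (take s S)) (trans (cong (length ws ⊓_)
          (trans (length-take s S) (m≤n⇒m⊓n≡m s≤S))) (m≥n⇒m⊓n≡n s≤ws))
        head∈ : ∀ {v x} → (v ∷ x) ∈ rows′ → v ∈ W
        head∈ z = All.lookup ws∈ (proj₁ (∈-zip z))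
        tail∈S : ∀ {v x} → (v ∷ x) ∈ rows′ → x ∈ S
        tail∈S z = ∈-resp-⊆ (take-⊆ s S) (proj₂ (∈-zip {xs = ws} z))
        tail∈ : ∀ {v x} → (v ∷ x) ∈ rows′ → x ∈ rows
        tail∈ z = ∈-resp-⊆ S⊆ (tail∈S z)

        rich′ : All (Rich′ i) rows′
        rich′ = All.tabulate λ { {v ∷ x} z → does-transfer (rich? i (w₀ ∷ x)) (rich? i (v ∷ x))
          (rich-same (tail∈ z) w₀∈ (head∈ z)) (All.lookup richS (tail∈S z)) }

        cross : ∀ k {v x v′ x′} → v ∈ W → x ∈ S → v′ ∈ W → x′ ∈ S → colour G v (lookup x k) ≡ colour G v′ (lookup x′ k)
        cross k v∈ x∈ v′∈ x′∈ = trans (colour-same k (∈-resp-⊆ S⊆ x∈) v∈ w₀∈)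
          (trans (sameS k x∈ x′∈) (colour-same k (∈-resp-⊆ S⊆ x′∈) w₀∈ v′∈))

        open Grid
        grid′ : Grid G rows′
        grid′ .clique zero = c ,
          AllPairs.map (λ { {_ ∷ _} {_ ∷ _} (e , _) → e }) (AllPairs-zip mono (universal (λ _ _ → tt) (take s S)))
        grid′ .clique (suc k) with clique grid k
        ... | c′ , ps = c′ , AllPairs.map (λ { {_ ∷ _} {_ ∷ _} (_ , e) → e })
          (AllPairs-zip mono (AllPairs-resp-⊆ (⊆-trans (take-⊆ s S) S⊆) ps))
        grid′ .homogeneous zero    zero     z≢z = contradiction refl z≢z
        grid′ .homogeneous zero    (suc k′) _ {_ ∷ _} {_ ∷ _} {_ ∷ _} {_ ∷ _} x y x′ y′ =
          cross k′ (head∈ x) (tail∈S y) (head∈ x′) (tail∈S y′)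
        grid′ .homogeneous (suc k) zero     _ {_ ∷ _} {_ ∷ _} {_ ∷ _} {_ ∷ _} x y x′ y′ = trans (symmetric G _ _)
          (trans (cross k (head∈ y) (tail∈S x) (head∈ y′) (tail∈S x′)) (symmetric G _ _))
        grid′ .homogeneous (suc k) (suc k′) k≢ {_ ∷ _} {_ ∷ _} {_ ∷ _} {_ ∷ _} x y x′ y′ =
          homogeneous grid k k′ (k≢ ∘ cong suc) (tail∈ x) (tail∈ y) (tail∈ x′) (tail∈ y′)

    step : ∀ {i j} s (rows : List (Vec (Fin n) j)) → 1 ≤ s → j ≤ K → length rows ≡ shrink * s →
      needed (shrink * s) ≤ n → All (Rich′ (suc i)) rows → Grid G rows →
      ∃[ rows′ ] (length rows′ ≡ s × All (Rich′ {suc j} i) rows′ × Grid G rows′)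
    step {i} {j} s rows 1≤s j≤K len n≥ rich grid = go (popular-class i rows (≤-trans 1≤s s≤m) j≤K
        (subst (λ z → needed z ≤ n) (sym len) n≥) rich)
      where
      s≤m : s ≤ length rows
      s≤m = ≤-trans (m≤n*m s shrink {{shrink≢0}}) (≤-reflexive (sym len))
      Goal : Set
      Goal = ∃[ rows′ ] (length rows′ ≡ s × All (Rich′ {suc j} i) rows′ × Grid G rows′)
      go : ∃[ W ] (Unique W × p ^ (suc r * length rows) ≤ length W × Indistinguishable i rows W ×
        All (λ v → length rows ≤ 2 * M⁺ * length (rich-rows i rows v)) W) → Goal
      go ([] , _ , p^≤ , _) = contradiction p^≤ (<⇒≱ (m^n>0 p (suc r * length rows)))
      go (w₀ ∷ W , uW , p^≤ , ind , pop) =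
        let S , S⊆ , m≤S , richS , sameS = similar-rows i rows w₀ j≤K (All.head pop)
            ws , c , s≤ws , ws∈ , mono = monochromatic-clique s (w₀ ∷ W) uW
              (≤-trans (^-monoʳ-≤ p (*-monoʳ-≤ (suc r) s≤m)) p^≤)
        in join i rows s ind (here refl) S⊆ richS sameS ws∈ mono s≤ws
             (*-cancelˡ-≤ shrink {{shrink≢0}} (≤-trans (≤-reflexive (sym len)) m≤S)) grid

    extend : ∀ i {j} m (rows : List (Vec (Fin n) j)) → 1 ≤ m → i + j ≡ K → length rows ≡ shrink ^ i * m →
      needed (shrink ^ i * m) ≤ n → All (Rich′ i) rows → Grid G rows →
      ∃[ rows′ ] (length rows′ ≡ m × All (Rich′ {K} 0) rows′ × Grid G rows′)
    extend zero    m rows 1≤m refl len n≥ rich grid = rows , trans len (+-identityʳ m) , rich , grid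
    extend (suc i) {j} m rows 1≤m eq len n≥ rich grid =
      let len₁ = *-assoc shrink (shrink ^ i) m
          rows′ , len′ , rich′ , grid′ = step (shrink ^ i * m) rows s≥1 (≤-trans (m≤n+m j (suc i)) (≤-reflexive eq))
            (trans len len₁) (subst (λ z → needed z ≤ n) len₁ n≥) rich grid
      in extend i m rows′ 1≤m (trans (+-suc i j) eq) len′ (≤-trans (needed-mono (m≤n*m (shrink ^ i * m) shrink)) (subst (λ z → needed z ≤ n) len₁ n≥)) rich′ grid′
      where
      instance
        _ = shrink≢0
      s≥1 : 1 ≤ shrink ^ i * m
      s≥1 = *-mono-≤ (m^n>0 shrink i) 1≤m
      needed-mono : ∀ {a b} → a ≤ b → needed a ≤ needed b
      needed-mono a≤b = *-monoʳ-≤ (2 * M⁺) (*-mono-≤ (*-mono-≤ (^-monoʳ-≤ 2 a≤b) (^-monoʳ-≤ p (*-monoˡ-≤ K a≤b)))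
        (^-monoʳ-≤ p (*-monoʳ-≤ (suc r) a≤b)))

    grid-exists : ∀ m → 1 ≤ m → needed (shrink ^ K * m) ≤ n → Rich′ K [] →
      ∃[ rows ] (length rows ≡ m × All (Rich′ {K} 0) rows × Grid G rows)
    -- The climb starts from copies of the empty row, as many as leave m rows after K divisions by
    -- `shrink`. Entries become distinct once a clique is attached as a column.
    grid-exists m 1≤m n≥ rich = extend K m (List.replicate (shrink ^ K * m) []) 1≤m (+-identityʳ K)
      (length-replicate (shrink ^ K * m)) n≥ (All.replicate⁺ (shrink ^ K * m) rich)
      record { clique = λ () ; homogeneous = λ () }

  -- From grids to homogeneous blow-ups

  fromList : ∀ {n} → List (Fin n) → Subset n
  fromList []       = Subset.⊥
  fromList (v ∷ vs) = ⁅ v ⁆ ∪ fromList vs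

  ∈-fromList⁻ : ∀ {n} {v : Fin n} vs → v Subset.∈ fromList vs → v ∈ vs
  ∈-fromList⁻ []       h = contradiction h Subset.∉⊥
  ∈-fromList⁻ (w ∷ vs) h with Subset.x∈p∪q⁻ ⁅ w ⁆ (fromList vs) h
  ... | inj₁ v∈w  = here (Subset.x∈⁅y⁆⇒x≡y w v∈w)
  ... | inj₂ v∈vs = there (∈-fromList⁻ vs v∈vs)

  length≤∣fromList∣ : ∀ {n} {vs : List (Fin n)} → Unique vs → length vs ≤ ∣ fromList vs ∣
  length≤∣fromList∣ []                        = z≤n
  length≤∣fromList∣ {vs = v ∷ vs} (v∉vs ∷ u) = ≤-<-trans (length≤∣fromList∣ u) (Subset.p⊂q⇒∣p∣<∣q∣
    (Subset.q⊆p∪q ⁅ v ⁆ (fromList vs) , v , Subset.x∈p∪q⁺ (inj₁ (Subset.x∈⁅x⁆ v)) ,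
     λ v∈ → All.lookup v∉vs (∈-fromList⁻ vs v∈) refl))

  induced : ∀ {r n k} → ColouredGraph r n → Vec (Fin n) k → ColouredGraph r k
  induced G x = record
    { colour      = λ i j → colour G (lookup x i) (lookup x j)
    ; symmetric   = λ i j → symmetric G (lookup x i) (lookup x j)
    ; irreflexive = λ i → irreflexive G (lookup x i)
    }

  module _ {r n : ℕ} (G : ColouredGraph r n) where

    just⇒≢ : ∀ {u v c} → colour G u v ≡ just c → u ≢ v
    just⇒≢ {u} e refl = contradiction (trans (sym (irreflexive G u)) e) λ ()

    related : ∀ {A : Set} {f : A → Fin n} {c} {xs : List A} → AllPairs (λ x y → colour G (f x) (f y) ≡ just c) xs →
      ∀ {u v} → u ∈ map f xs → v ∈ map f xs → u ≢ v → colour G u v ≡ just c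
    related {xs = _ ∷ _} (p ∷ ps) (here refl) (here refl) u≢v = contradiction refl u≢v
    related {f = f} {xs = _ ∷ _} (p ∷ ps) (here refl) (there j) u≢v with ∈-map⁻ f j
    ... | y , y∈ , refl = All.lookup p y∈
    related {f = f} {xs = _ ∷ _} (p ∷ ps) (there i) (here refl) u≢v with ∈-map⁻ f i
    ... | y , y∈ , refl = trans (symmetric G _ _) (All.lookup p y∈)
    related {xs = _ ∷ _} (p ∷ ps) (there i) (there j) u≢v = related ps i j u≢v

    -- By homogeneity the first row already shows all colours between parts, so it induces H. A
    -- second row is displayed because disjointness compares two entries of one column.
    grid⇒blow-up : ∀ {k t} x y (zs : List (Vec (Fin n) k)) → Complete G → Grid G (x ∷ y ∷ zs) →
      (∀ (S : Subset n) → length (x ∷ y ∷ zs) ≤ ∣ S ∣ → t ≤ℝ fromℕ ∣ S ∣) → HomogeneousBlowUp t (induced G x) G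
    grid⇒blow-up {k} x y zs complete grid t≤ = record
      { part          = λ i → fromList (column i)
      ; disjoint      = λ i j i≢j (v , v∈) → let v∈i , v∈j = Subset.x∈p∩q⁻ _ _ v∈
                                             in disj i≢j (∈-fromList⁻ (column i) v∈i) (∈-fromList⁻ (column j) v∈j)
      ; large         = λ i → t≤ (fromList (column i)) (subst (_≤ ∣ fromList (column i) ∣) (length-map _ rows) (length≤∣fromList∣
                          (AllPairs.map⁺ (AllPairs.map just⇒≢ (proj₂ (clique i))))))
      ; monochromatic = λ i → proj₁ (clique i) , λ u v u∈ v∈ → related (proj₂ (clique i)) (∈-fromList⁻ (column i) u∈) (∈-fromList⁻ (column i) v∈)
      ; joined        = λ i j c e u v u∈ v∈ → join′ i j e (∈-fromList⁻ (column i) u∈) (∈-fromList⁻ (column j) v∈)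
      }
      where
      open Grid grid
      rows : List (Vec (Fin n) k)
      rows = x ∷ y ∷ zs
      column : Fin k → List (Fin n)
      column i = map (λ x → lookup x i) rows

      -- If the columns i and j met, then, by homogeneity and as distinct vertices are adjacent, each
      -- column would be constant.
      disj : ∀ {i j} → i ≢ j → ∀ {v} → v ∈ column i → ¬ v ∈ column j
      disj {i} {j} i≢j v∈i v∈j with ∈-map⁻ _ v∈i | ∈-map⁻ _ v∈j
      ... | a , a∈ , e | b , b∈ , e′ = just⇒≢ (All.head (AllPairs.head (proj₂ (clique i))))
        (trans (coincide (here refl) (here refl)) (sym (coincide (there (here refl)) (here refl))))
        where
        coincide : ∀ {p q} → p ∈ rows → q ∈ rows → lookup p i ≡ lookup q j
        coincide {p} {q} p∈ q∈ with lookup p i Fin.≟ lookup q j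
        ... | yes eq = eq
        ... | no ne  with complete _ _ ne
        ...   | c , ec = contradiction (trans (sym e) e′) (just⇒≢ (trans (homogeneous i j i≢j a∈ b∈ p∈ q∈) ec))

      join′ : ∀ i j {c u v} → colour G (lookup x i) (lookup x j) ≡ just c → u ∈ column i → v ∈ column j → colour G u v ≡ just c
      join′ i j {c} e u∈ v∈ with ∈-map⁻ _ u∈ | ∈-map⁻ _ v∈
      ... | a , a∈ , refl | b , b∈ , refl = trans (homogeneous i j (λ { refl → just⇒≢ e refl }) a∈ b∈ (here refl) (here refl)) e

  -- Bernoulli inequalities and the choice of parameters

  2*n^n≤[1+n]^[1+n] : ∀ n .{{_ : NonZero n}} → n ^ suc n * 2 ≤ suc n ^ suc n
  -- That is, (1 + 1/n)^(n+1) ≥ 2, from Bernoulli's inequality (1 + 1/n)^k ≥ 1 + k/n at k = n + 1,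
  -- with denominators cleared.
  2*n^n≤[1+n]^[1+n] n = *-cancelʳ-≤ (n ^ suc n * 2) (suc n ^ suc n) n (≤-trans
    (≤-trans (≤-reflexive (*-assoc (n ^ suc n) 2 n)) (*-monoʳ-≤ (n ^ suc n)
      (≤-trans (≤-reflexive (cong (n +_) (+-identityʳ n))) (+-monoʳ-≤ n (n≤1+n n))))) (bernoulli (suc n)))
    where
    open ≤-Reasoning
    bernoulli : ∀ k → n ^ k * (n + k) ≤ suc n ^ k * n
    bernoulli zero    = ≤-reflexive (cong (_+ 0) (+-identityʳ n))
    bernoulli (suc k) = begin
      n * n ^ k * (n + suc k)
        ≡⟨ solve 3 (λ n k p → n :* p :* (n :+ (con 1 :+ k)) := p :* (n :* n :+ n :* k :+ n)) refl n k (n ^ k) ⟩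
      n ^ k * (n * n + n * k + n)
        ≤⟨ *-monoʳ-≤ (n ^ k) (m≤m+n _ k) ⟩
      n ^ k * (n * n + n * k + n + k)
        ≡⟨ solve 3 (λ n k p → p :* (n :* n :+ n :* k :+ n :+ k) := (con 1 :+ n) :* (p :* (n :+ k))) refl n k (n ^ k) ⟩
      suc n * (n ^ k * (n + k))
        ≤⟨ *-monoʳ-≤ (suc n) (bernoulli k) ⟩
      suc n * (suc n ^ k * n)
        ≡⟨ sym (*-assoc (suc n) (suc n ^ k) n) ⟩
      suc n * suc n ^ k * n ∎

  -- Bernoulli's inequality (1 - 1/(n+1))^k ≥ 1 - k/(n+1); `e` stands for n + 1 - k and avoids
  -- truncated subtraction.
  bernoulli⁻ : ∀ n k e → k + e ≡ suc n → suc n ^ k * e ≤ suc n * n ^ k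
  bernoulli⁻ n zero    e refl = ≤-reflexive (trans (+-identityʳ e) (sym (*-identityʳ e)))
  bernoulli⁻ n (suc k) e eq   = begin
    suc n * suc n ^ k * e
      ≡⟨ solve 3 (λ n p e → (con 1 :+ n) :* p :* e := p :* (e :+ e :* n)) refl n (suc n ^ k) e ⟩
    suc n ^ k * (e + e * n)
      ≤⟨ *-monoʳ-≤ (suc n ^ k) (+-monoˡ-≤ (e * n) (≤-trans (m≤n+m e k) (≤-reflexive (suc-injective eq)))) ⟩
    suc n ^ k * (suc e * n)
      ≡⟨ sym (*-assoc (suc n ^ k) (suc e) n) ⟩
    suc n ^ k * suc e * n
      ≤⟨ *-monoˡ-≤ n (bernoulli⁻ n k (suc e) (trans (+-suc k e) eq)) ⟩
    suc n * n ^ k * n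
      ≡⟨ solve 3 (λ m p n → m :* p :* n := m :* (n :* p)) refl (suc n) (n ^ k) n ⟩
    suc n * (n * n ^ k) ∎
    where open ≤-Reasoning

  ^-distribʳ-* : ∀ k a b → (a * b) ^ k ≡ a ^ k * b ^ k
  ^-distribʳ-* zero    a b = refl
  ^-distribʳ-* (suc k) a b rewrite ^-distribʳ-* k a b =
    solve 4 (λ a b p q → a :* b :* (p :* q) := a :* p :* (b :* q)) refl a b (a ^ k) (b ^ k)

  -- The choice of the number K = 1 + D j of vertices of H for degrees at least n/D.
  module Parameters (D′ p : ℕ) .{{_ : NonZero D′}} (D≤ : suc D′ ≤ 2 ^ (p + 3)) where

    -- j is chosen for 2 K D < 2^j: D² ≤ 2^(2p+6) and 2 (j+1) < 2^(p+7), with exponents adding up to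
    -- 3p + 13. M = 1 + M′ is 2 K, so that (1 - 1/M)^K ≥ 1/2.
    D j k K M′ : ℕ
    D  = suc D′
    j  = 3 * p + 13
    k  = D * j
    K  = suc k
    M′ = suc (k + k)

    K+K≡M : K + K ≡ suc M′
    K+K≡M = cong suc (+-suc k k)

    K≤ : K ≤ D * suc j
    K≤ = ≤-trans (s≤s (m≤n+m k D′)) (≤-reflexive (sym (*-suc D j)))

    2KD<2^j : 2 * (K * D) < 2 ^ j
    2KD<2^j = begin-strict
      2 * (K * D)
        ≤⟨ *-monoʳ-≤ 2 (*-monoˡ-≤ D K≤) ⟩
      2 * (D * suc j * D)
        ≡⟨ solve 2 (λ D j → con 2 :* (D :* j :* D) := D :* D :* (con 2 :* j)) refl D (suc j) ⟩
      D * D * (2 * suc j)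
        ≤⟨ *-monoˡ-≤ (2 * suc j) (*-mono-≤ D≤ D≤) ⟩
      2 ^ (p + 3) * 2 ^ (p + 3) * (2 * suc j)
        <⟨ *-monoʳ-< (2 ^ (p + 3) * 2 ^ (p + 3)) {{m*n≢0 _ _ {{m^n≢0 2 (p + 3)}} {{m^n≢0 2 (p + 3)}}}} (*-monoʳ-< 2 (small p)) ⟩
      2 ^ (p + 3) * 2 ^ (p + 3) * (2 * 2 ^ (p + 6))
        ≡⟨ cong (_* (2 * 2 ^ (p + 6))) (sym (^-distribˡ-+-* 2 (p + 3) (p + 3))) ⟩
      2 ^ (p + 3 + (p + 3)) * (2 * 2 ^ (p + 6))
        ≡⟨ sym (^-distribˡ-+-* 2 (p + 3 + (p + 3)) (suc (p + 6))) ⟩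
      2 ^ (p + 3 + (p + 3) + suc (p + 6))
        ≡⟨ cong (2 ^_) (solve 1 (λ p → p :+ con 3 :+ (p :+ con 3) :+ (con 1 :+ (p :+ con 6)) := con 3 :* p :+ con 13) refl p) ⟩
      2 ^ j ∎
      where
      open ≤-Reasoning
      small : ∀ p → suc (3 * p + 13) < 2 ^ (p + 6)
      small zero    = m≤m+n 15 49
      small (suc p) = begin-strict
        suc (3 * suc p + 13)    ≡⟨ solve 1 (λ p → con 1 :+ (con 3 :* (con 1 :+ p) :+ con 13) := con 3 :* p :+ con 13 :+ con 4) refl p ⟩
        3 * p + 13 + 4          ≤⟨ +-mono-≤ (n≤1+n (3 * p + 13)) (≤-trans (m≤m+n 4 9) (≤-trans (m≤n+m 13 (3 * p)) (n≤1+n _))) ⟩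
        suc (3 * p + 13) + suc (3 * p + 13) <⟨ +-mono-< (small p) (small p) ⟩
        2 ^ (p + 6) + 2 ^ (p + 6) ≡⟨ cong (2 ^ (p + 6) +_) (sym (+-identityʳ _)) ⟩
        2 ^ (suc p + 6) ∎

    -- After division by (n M)^K the left side is K r (q/n)^k ≤ K D (1 - 1/D)^(D j) ≤ K D / 2^j <
    -- 1/2, the right side (1 - 1/M)^K ≥ 1/2.
    rich-inequality : ∀ {r n q} → r ≤ D → .{{_ : NonZero n}} → D * q ≤ D′ * n →
      K * r * (n * q ^ k) * suc M′ ^ K < (n * M′) ^ K
    rich-inequality {r} {n} {q} r≤D Dq≤ = *-cancelˡ-< (D ^ k * 2 ^ j) _ _ (begin-strict
      D ^ k * 2 ^ j * (K * r * (n * q ^ k) * suc M′ ^ K)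
        ≤⟨ *-monoʳ-≤ (D ^ k * 2 ^ j) (*-monoʳ-≤ (K * r * (n * q ^ k)) M^≤) ⟩
      D ^ k * 2 ^ j * (K * r * (n * q ^ k) * (2 * M′ ^ K))
        ≡⟨ solve 7 (λ d t a r n q m → d :* t :* (a :* r :* (n :* q) :* (con 2 :* m)) := t :* (con 2 :* (a :* r)) :* (d :* q) :* (n :* m))
             refl (D ^ k) (2 ^ j) K r n (q ^ k) (M′ ^ K) ⟩
      2 ^ j * (2 * (K * r)) * (D ^ k * q ^ k) * (n * M′ ^ K)
        ≤⟨ *-monoˡ-≤ (n * M′ ^ K) (*-monoʳ-≤ (2 ^ j * (2 * (K * r))) (≤-trans (≤-reflexive (sym (^-distribʳ-* k D q)))
             (≤-trans (^-monoˡ-≤ k Dq≤) (≤-reflexive (^-distribʳ-* k D′ n))))) ⟩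
      2 ^ j * (2 * (K * r)) * (D′ ^ k * n ^ k) * (n * M′ ^ K)
        ≡⟨ solve 6 (λ t a d p n m → t :* a :* (d :* p) :* (n :* m) := t :* d :* a :* (n :* p :* m))
             refl (2 ^ j) (2 * (K * r)) (D′ ^ k) (n ^ k) n (M′ ^ K) ⟩
      2 ^ j * D′ ^ k * (2 * (K * r)) * (n ^ K * M′ ^ K)
        ≤⟨ *-monoˡ-≤ (n ^ K * M′ ^ K) (*-mono-≤ halve (*-monoʳ-≤ 2 (*-monoʳ-≤ K r≤D))) ⟩
      D ^ k * (2 * (K * D)) * (n ^ K * M′ ^ K)
        <⟨ *-monoˡ-< (n ^ K * M′ ^ K) {{m*n≢0 _ _ {{m^n≢0 n K}} {{m^n≢0 M′ K}}}} (*-monoʳ-< (D ^ k) {{m^n≢0 D k}} 2KD<2^j) ⟩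
      D ^ k * 2 ^ j * (n ^ K * M′ ^ K)
        ≡⟨ cong (D ^ k * 2 ^ j *_) (sym (^-distribʳ-* K n M′)) ⟩
      D ^ k * 2 ^ j * (n * M′) ^ K ∎)
      where
      open ≤-Reasoning
      M^≤ : suc M′ ^ K ≤ 2 * M′ ^ K
      M^≤ = *-cancelʳ-≤ _ _ K (≤-trans (bernoulli⁻ M′ K K K+K≡M) (≤-reflexive (trans (cong (_* M′ ^ K) (sym K+K≡M))
        (solve 2 (λ k m → (k :+ k) :* m := con 2 :* m :* k) refl K (M′ ^ K)))))
      halve : 2 ^ j * D′ ^ k ≤ D ^ k
      halve = begin
        2 ^ j * D′ ^ (D * j)   ≡⟨ cong (2 ^ j *_) (sym (^-*-assoc D′ D j)) ⟩
        2 ^ j * (D′ ^ D) ^ j   ≡⟨ trans (sym (^-distribʳ-* j 2 (D′ ^ D))) (cong (_^ j) (*-comm 2 (D′ ^ D))) ⟩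
        (D′ ^ D * 2) ^ j       ≤⟨ ^-monoˡ-≤ j (2*n^n≤[1+n]^[1+n] D′) ⟩
        (D ^ D) ^ j            ≡⟨ ^-*-assoc D D j ⟩
        D ^ k ∎

    module _ (r : ℕ) where

      -- `c` is the `shrink` of the construction, and `X` is such that m₀ rows need at most X^m₀
      -- vertices. As the climb starts with m₀ = c^K m rows, base^m vertices suffice.
      c X base : ℕ
      c = 2 * suc M′ * suc (suc r) ^ K
      X = 2 * suc M′ * (2 * suc (suc r) ^ K * suc (suc r) ^ suc r)
      base = X ^ (c ^ K)

      c≢0 : NonZero c
      c≢0 = m*n≢0 (2 * suc M′) (suc (suc r) ^ K) {{_}} {{m^n≢0 (suc (suc r)) K}}

      2≤base : 2 ≤ base
      2≤base = ≤-trans 2≤X (≤-trans (≤-reflexive (sym (*-identityʳ X))) (^-monoʳ-≤ X {{>-nonZero (≤-trans (s≤s z≤n) 2≤X)}} (m^n>0 c {{c≢0}} K)))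
        where
        2≤X : 2 ≤ X
        2≤X = *-mono-≤ {2} {2 * suc M′} {1} (m≤m*n 2 (suc M′)) (*-mono-≤ {1} {2 * suc (suc r) ^ K} {1}
          (*-mono-≤ {1} {2} {1} (s≤s z≤n) (m^n>0 (suc (suc r)) K)) (m^n>0 (suc (suc r)) (suc r)))

      module _ {n : ℕ} (G : ColouredGraph (suc r) n) (complete : Complete G) .{{_ : NonZero n}}
               (r≤D : suc r ≤ D) (balanced : ∀ u c → n ≤ D * degree G c u) where

        -- Rounding (1 - 1/D) n down still bounds the integers that count non-neighbours, and keeps
        -- D q ≤ D′ n for `rich-inequality`.
        q : ℕ
        q = (D′ * n) / D

        D*off≤ : ∀ u c → D * ∑ (allFin n) (Estimator.off G u c) ≤ D′ * n
        D*off≤ u c = +-cancelʳ-≤ n _ _ (begin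
          D * o + n             ≤⟨ +-monoʳ-≤ (D * o) (balanced u c) ⟩
          D * o + D * degree G c u ≡⟨ sym (*-distribˡ-+ D o (degree G c u)) ⟩
          D * (o + degree G c u)   ≡⟨ cong (D *_) (Estimator.∑-off G u c) ⟩
          D * n                 ≡⟨ +-comm n (D′ * n) ⟩
          D′ * n + n ∎)
          where
          open ≤-Reasoning
          o : ℕ
          o = ∑ (allFin n) (Estimator.off G u c)

        off≤q : ∀ u c → ∑ (allFin n) (Estimator.off G u c) ≤ q
        off≤q u c = subst (_≤ q) (m*n/n≡m _ D) (/-monoˡ-≤ D (subst (_≤ D′ * n) (*-comm D _) (D*off≤ u c)))

        blow-up-exists : ∀ m {t} → 2 ≤ m → base ^ m ≤ n → (∀ (S : Subset n) → m ≤ ∣ S ∣ → t ≤ℝ fromℕ ∣ S ∣) →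
          Σ[ H ∈ ColouredGraph (suc r) K ] (Unibalanced H × HomogeneousBlowUp t H G)
        blow-up-exists m {t} 2≤m base^m≤n t≤ = go
          (grid-exists m (≤-trans (s≤s z≤n) 2≤m) (≤-trans needed≤ base^m≤n)
            (Estimator.rich-[] G q off≤q M′ k (rich-inequality r≤D (subst (_≤ D′ * n) (*-comm q D) (m/n*n≤m (D′ * n) D)))))
          where
          open Construction G complete q off≤q M′ K using (grid-exists; Rich′)
          go : ∃[ rows ] (length rows ≡ m × All (Rich′ {K} 0) rows × Grid G rows) →
            Σ[ H ∈ ColouredGraph (suc r) K ] (Unibalanced H × HomogeneousBlowUp t H G)
          go ([]         , refl , _) = contradiction 2≤m λ ()
          go (x ∷ []     , refl , _) = contradiction 2≤m λ { (s≤s ()) }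
          go (x ∷ y ∷ zs , refl , rich ∷ _ , grid) = induced G x ,
            (λ v c → Estimator.rich⇒unibalanced G q off≤q M′ x rich v c) ,
            grid⇒blow-up G x y zs complete grid t≤
          m₀ P R : ℕ
          m₀ = c ^ K * m
          P = suc (suc r) ^ K
          R = suc (suc r) ^ suc r
          1≤m₀ : 1 ≤ m₀
          1≤m₀ = *-mono-≤ (m^n>0 c {{c≢0}} K) (≤-trans (s≤s z≤n) 2≤m)
          needed≤ : 2 * suc M′ * (2 ^ m₀ * suc (suc r) ^ (m₀ * K) * suc (suc r) ^ (suc r * m₀)) ≤ base ^ m
          needed≤ = begin
            2 * suc M′ * (2 ^ m₀ * suc (suc r) ^ (m₀ * K) * suc (suc r) ^ (suc r * m₀))
              ≡⟨ cong (2 * suc M′ *_) (cong₂ (λ a b → 2 ^ m₀ * a * b)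
                   (trans (cong (suc (suc r) ^_) (*-comm m₀ K)) (sym (^-*-assoc (suc (suc r)) K m₀))) (sym (^-*-assoc (suc (suc r)) (suc r) m₀))) ⟩
            2 * suc M′ * (2 ^ m₀ * P ^ m₀ * R ^ m₀)
              ≡⟨ cong (2 * suc M′ *_) (sym (trans (^-distribʳ-* m₀ (2 * P) R) (cong (_* R ^ m₀) (^-distribʳ-* m₀ 2 P)))) ⟩
            2 * suc M′ * (2 * P * R) ^ m₀
              ≤⟨ *-monoˡ-≤ ((2 * P * R) ^ m₀) (≤-trans (≤-reflexive (sym (*-identityʳ (2 * suc M′)))) (^-monoʳ-≤ (2 * suc M′) 1≤m₀)) ⟩
            (2 * suc M′) ^ m₀ * (2 * P * R) ^ m₀
              ≡⟨ sym (^-distribʳ-* m₀ (2 * suc M′) (2 * P * R)) ⟩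
            X ^ m₀
              ≡⟨ sym (^-*-assoc X (c ^ K) m) ⟩
            base ^ m ∎
            where open ≤-Reasoning

module Analysis where

  open Combinatorics using (∑; ∑-const; ∑-mono; ∑-*ˡ; length-allFin; module Estimator; module Parameters)
  open import Data.Nat.Base as ℕ using (zero; suc)
  import Data.Nat.Properties as ℕ
  import Data.Nat.Solver as ℕSolver
  import Data.Integer.Base as ℤ
  import Data.Rational.Unnormalised.Base as ℚᵘ
  import Data.Rational.Unnormalised.Properties as ℚᵘ
  open import Data.Rational.Base hiding (NonZero; >-nonZero)
  open import Data.Rational.Properties
  open import Data.Rational.Solver using (module +-*-Solver)
  open +-*-Solver using (solve; _:+_; _:*_; _:-_; :-_; _:=_; con)

  -- A piecewise linear substitute for the logarithm

  2ℚ ¾ : ℚ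
  2ℚ = 1ℚ + 1ℚ
  ¾ = ℤ.+ 3 / 4

  -- Inequalities are proved by writing the difference of both sides as a visibly nonnegative expression.
  ≤-by : ∀ {p q d} → 0ℚ ≤ d → d ≡ q - p → p ≤ q
  ≤-by {p} {q} 0≤d refl = subst₂ _≤_ (+-identityˡ p) (solve 2 (λ p q → q :- p :+ p := q) refl p q) (+-monoˡ-≤ p 0≤d)

  <⇒≱ : ∀ {p q} → p < q → ¬ q ≤ p
  <⇒≱ p<q q≤p = <-irrefl refl (<-≤-trans p<q q≤p)

  0≤- : ∀ {p q} → p ≤ q → 0ℚ ≤ q - p
  0≤- {p} {q} p≤q = subst (_≤ q - p) (+-inverseʳ p) (+-monoˡ-≤ (- p) p≤q)

  0≤+ : ∀ {p q} → 0ℚ ≤ p → 0ℚ ≤ q → 0ℚ ≤ p + q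
  0≤+ = +-mono-≤

  -- On [1 , 2^ℓ], the piecewise linear interpolation of log₂ at the powers of 2, whose slope at s lies
  -- between 1/s and 2/s; constant from 2^ℓ on.
  Λ : ℕ → ℚ → ℚ
  Λ zero    s = 0ℚ
  Λ (suc ℓ) s with s ≤? 2ℚ
  ... | yes _ = s - 1ℚ
  ... | no _  = 1ℚ + Λ ℓ (½ * s)

  Λ-1 : ∀ ℓ → Λ ℓ 1ℚ ≡ 0ℚ
  Λ-1 zero    = refl
  Λ-1 (suc ℓ) = refl

  1≤½* : ∀ {s} → 2ℚ ≤ s → 1ℚ ≤ ½ * s
  1≤½* 2≤s = *-monoˡ-≤-nonNeg ½ 2≤s

  Λ≤ : ∀ ℓ s → Λ ℓ s ≤ nat ℓ
  Λ≤ zero    s = ≤-refl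
  Λ≤ (suc ℓ) s with s ≤? 2ℚ
  ... | yes s≤2 = ≤-trans (+-monoˡ-≤ (- 1ℚ) s≤2) (≤-trans (≤-reflexive (sym (+-identityʳ 1ℚ))) (+-monoʳ-≤ 1ℚ (0≤nat ℓ)))
  ... | no _    = +-monoʳ-≤ 1ℚ (Λ≤ ℓ (½ * s))

  -- Beyond s the slope is at most 2/s. The inequality is homogeneous, so halving both points lowers
  -- the level; if 2 separates s and t, the increment is split at 2.
  Λ-concave : ∀ ℓ {s t} → 1ℚ ≤ s → s ≤ t → s * (Λ ℓ t - Λ ℓ s) ≤ 2ℚ * (t - s)
  Λ-concave zero    {s} {t} 1≤s s≤t = subst (_≤ 2ℚ * (t - s)) (sym (*-zeroʳ s)) (0≤* (from-yes (0ℚ ≤? 2ℚ)) (0≤- s≤t))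
  Λ-concave (suc ℓ) {s} {t} 1≤s s≤t with s ≤? 2ℚ | t ≤? 2ℚ
  ... | yes s≤2 | yes t≤2 = ≤-by (0≤* (0≤- s≤2) (0≤- s≤t))
    (solve 3 (λ s t w → (w :- s) :* (t :- s) := w :* (t :- s) :- s :* ((t :- con 1ℚ) :- (s :- con 1ℚ))) refl s t 2ℚ)
  ... | yes s≤2 | no t≰2 = ≤-by
    (0≤+ (0≤* (≤-trans 0≤1 1≤s) (0≤- a≤)) (0≤* (0≤- s≤2) (0≤- s≤t)))
    (solve 3 (λ s t a → s :* ((t :- con 2ℚ) :- a) :+ (con 2ℚ :- s) :* (t :- s)
                     := con 2ℚ :* (t :- s) :- s :* ((con 1ℚ :+ a) :- (s :- con 1ℚ))) refl s t (Λ ℓ (½ * t)))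
    where
    a≤ : Λ ℓ (½ * t) ≤ t - 2ℚ
    a≤ = subst₂ _≤_
      (trans (*-identityˡ (Λ ℓ (½ * t) - Λ ℓ 1ℚ)) (trans (cong (λ z → Λ ℓ (½ * t) - z) (Λ-1 ℓ)) (+-identityʳ (Λ ℓ (½ * t)))))
      (solve 1 (λ t → con 2ℚ :* (con ½ :* t :- con 1ℚ) := t :- con 2ℚ) refl t)
      (Λ-concave ℓ ≤-refl (1≤½* (<⇒≤ (≰⇒> t≰2))))
  ... | no s≰2 | yes t≤2 = contradiction (≤-trans s≤t t≤2) s≰2
  ... | no s≰2 | no t≰2 = ≤-by
    (0≤* (from-yes (0ℚ ≤? 2ℚ)) (0≤- (Λ-concave ℓ (1≤½* (<⇒≤ (≰⇒> s≰2))) (*-monoˡ-≤-nonNeg ½ s≤t))))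
    (solve 4 (λ s t a b → con 2ℚ :* (con 2ℚ :* (con ½ :* t :- con ½ :* s) :- con ½ :* s :* (a :- b))
                       := con 2ℚ :* (t :- s) :- s :* ((con 1ℚ :+ a) :- (con 1ℚ :+ b))) refl s t (Λ ℓ (½ * t)) (Λ ℓ (½ * s)))

  nat-+ : ∀ m n → nat (m ℕ.+ n) ≡ nat m + nat n
  nat-+ zero    n = sym (+-identityˡ (nat n))
  nat-+ (suc m) n = trans (cong (1ℚ +_) (nat-+ m n)) (sym (+-assoc 1ℚ (nat m) (nat n)))

  nat-* : ∀ m n → nat (m ℕ.* n) ≡ nat m * nat n
  nat-* zero    n = sym (*-zeroˡ (nat n))
  nat-* (suc m) n = trans (nat-+ n (m ℕ.* n)) (trans (cong (nat n +_) (nat-* m n))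
    (solve 2 (λ m n → n :+ m :* n := (con 1ℚ :+ m) :* n) refl (nat m) (nat n)))

  nat-cancel-≤ : ∀ {m n} → nat m ≤ nat n → m ℕ.≤ n
  nat-cancel-≤ {m} {n} h with m ℕ.≤? n
  ... | yes m≤n = m≤n
  ... | no m≰n  = contradiction (≤-trans (nat-mono (ℕ.≰⇒> m≰n)) h)
    (<⇒≱ (subst (_< 1ℚ + nat n) (+-identityˡ (nat n)) (+-monoˡ-< (nat n) 0<1)))

  fromℕ≡nat : ∀ n → ℤ.+ n / 1 ≡ nat n
  fromℕ≡nat n = toℚᵘ-injective (ℚᵘ.≃-trans (toℚᵘ-fromℚᵘ (ℚᵘ.mkℚᵘ (ℤ.+ n) 0)) (ℚᵘ.≃-sym (toℚᵘ-nat n)))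

  -- Up to t the slope is at least 1/t; the bound on t keeps away from the range where `Λ` is
  -- constant.
  Λ-steep : ∀ ℓ {s t} → 1ℚ ≤ s → s ≤ t → t ≤ nat (2 ℕ.^ ℓ) → t - s ≤ t * (Λ ℓ t - Λ ℓ s)
  Λ-steep zero    {s} {t} 1≤s s≤t t≤ = ≤-by (0≤- (≤-trans t≤ 1≤s))
    (solve 2 (λ s t → s :- t := t :* (con 0ℚ :- con 0ℚ) :- (t :- s)) refl s t)
  Λ-steep (suc ℓ) {s} {t} 1≤s s≤t t≤ with s ≤? 2ℚ | t ≤? 2ℚ
  ... | yes s≤2 | yes t≤2 = ≤-by (0≤* (0≤- (≤-trans 1≤s s≤t)) (0≤- s≤t))
    (solve 2 (λ s t → (t :- con 1ℚ) :* (t :- s) := t :* ((t :- con 1ℚ) :- (s :- con 1ℚ)) :- (t :- s)) refl s t)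
  ... | yes s≤2 | no t≰2 = ≤-by
    (0≤+ (0≤* (from-yes (0ℚ ≤? 2ℚ)) (0≤- (Λ-steep ℓ ≤-refl (1≤½* (<⇒≤ (≰⇒> t≰2))) ½t≤)))
         (0≤* (0≤- (≤-trans 1≤s s≤t)) (0≤- s≤2)))
    (trans (cong (λ z → 2ℚ * (½ * t * (Λ ℓ (½ * t) - z) - (½ * t - 1ℚ)) + (t - 1ℚ) * (2ℚ - s)) (Λ-1 ℓ))
      (solve 3 (λ s t a → con 2ℚ :* (con ½ :* t :* (a :- con 0ℚ) :- (con ½ :* t :- con 1ℚ)) :+ (t :- con 1ℚ) :* (con 2ℚ :- s)
                     := t :* ((con 1ℚ :+ a) :- (s :- con 1ℚ)) :- (t :- s)) refl s t (Λ ℓ (½ * t))))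
    where
    ½t≤ : ½ * t ≤ nat (2 ℕ.^ ℓ)
    ½t≤ = ≤-trans (*-monoˡ-≤-nonNeg ½ t≤) (≤-reflexive (trans (cong (½ *_) (nat-* 2 (2 ℕ.^ ℓ)))
      (solve 1 (λ n → con ½ :* (con 2ℚ :* n) := n) refl (nat (2 ℕ.^ ℓ)))))
  ... | no s≰2 | yes t≤2 = contradiction (≤-trans s≤t t≤2) s≰2
  ... | no s≰2 | no t≰2 = ≤-by
    (0≤* (from-yes (0ℚ ≤? 2ℚ)) (0≤- (Λ-steep ℓ (1≤½* (<⇒≤ (≰⇒> s≰2))) (*-monoˡ-≤-nonNeg ½ s≤t) ½t≤)))
    (solve 4 (λ s t a b → con 2ℚ :* (con ½ :* t :* (a :- b) :- (con ½ :* t :- con ½ :* s))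
                       := t :* ((con 1ℚ :+ a) :- (con 1ℚ :+ b)) :- (t :- s)) refl s t (Λ ℓ (½ * t)) (Λ ℓ (½ * s)))
    where
    ½t≤ : ½ * t ≤ nat (2 ℕ.^ ℓ)
    ½t≤ = ≤-trans (*-monoˡ-≤-nonNeg ½ t≤) (≤-reflexive (trans (cong (½ *_) (nat-* 2 (2 ℕ.^ ℓ)))
      (solve 1 (λ n → con ½ :* (con 2ℚ :* n) := n) refl (nat (2 ℕ.^ ℓ)))))

  -- On [2^p , 2^(p+1)] the interpolation is p - 1 + s/2^p, which is p + 3/4 at s = 7/4 · 2^p.
  Λ-large : ∀ p {q} → (1ℚ + ¾) * nat (2 ℕ.^ p) ≤ q → nat p + ¾ ≤ Λ (suc p) q
  Λ-large p {q} h with q ≤? 2ℚ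
  Λ-large zero    {q} h | yes q≤2 = +-monoˡ-≤ (- 1ℚ) h
  Λ-large (suc p) {q} h | yes q≤2 = contradiction (≤-trans h q≤2) (<⇒≱ (<-≤-trans (from-yes (2ℚ <? (1ℚ + ¾) * 2ℚ))
    (*-monoˡ-≤-nonNeg (1ℚ + ¾) (nat-mono (ℕ.^-monoʳ-≤ 2 {1} {suc p} (ℕ.s≤s ℕ.z≤n))))))
  Λ-large zero    {q} h | no q≰2 = from-yes (0ℚ + ¾ ≤? 1ℚ + 0ℚ)
  Λ-large (suc p) {q} h | no q≰2 = ≤-trans (≤-reflexive (+-assoc 1ℚ (nat p) ¾)) (+-monoʳ-≤ 1ℚ (Λ-large p (≤-trans
    (≤-reflexive (sym (trans (cong (λ z → ½ * ((1ℚ + ¾) * z)) (nat-* 2 (2 ℕ.^ p)))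
      (solve 2 (λ c n → con ½ :* (c :* (con 2ℚ :* n)) := c :* n) refl (1ℚ + ¾) (nat (2 ℕ.^ p))))))
    (*-monoˡ-≤-nonNeg ½ h))))

  -- Bounds for the Riemann sums of the logarithm

  module _ {_~_ : ℚ → ℚ → Set} (+-mono : ∀ {a b c d} → a ~ b → c ~ d → (a + c) ~ (b + d)) where

    -- The increments of F telescope over the cells. The relation is abstract so that one induction
    -- serves lower and upper bounds; c absorbs a factor ½ at each bisection.
    riemann-compare : ∀ n c {F f : ℚ → ℚ} →
      (∀ {s t} → In01 s → In01 t → t - s ≡ half^ n → (c * (t - s) * f s) ~ (F t - F s)) →
      (c * riemann n f) ~ (F 1ℚ - F 0ℚ)
    riemann-compare zero    c {F} {f} h = subst (_~ (F 1ℚ - F 0ℚ)) (cong (_* f 0ℚ) (*-identityʳ c))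
      (h (≤-refl , 0≤1) (0≤1 , ≤-refl) refl)
    riemann-compare (suc n) c {F} {f} h = subst₂ _~_
      (solve 4 (λ c k a b → c :* k :* a :+ c :* k :* b := c :* (k :* a :+ k :* b)) refl
        c ½ (riemann n (λ t → f (½ * t))) (riemann n (λ t → f (½ + ½ * t))))
      (solve 3 (λ a b c → (b :- a) :+ (c :- b) := c :- a) refl (F 0ℚ) (F ½) (F 1ℚ))
      (+-mono
        (riemann-compare n (c * ½) {λ t → F (½ * t)} {λ t → f (½ * t)} λ {s} {t} is it e →
          subst (λ z → (z * f (½ * s)) ~ (F (½ * t) - F (½ * s)))
            (solve 4 (λ c k s t → c :* (k :* t :- k :* s) := c :* k :* (t :- s)) refl c ½ s t)
            (h (left-half is) (left-half it)
              (trans (solve 3 (λ k s t → k :* t :- k :* s := k :* (t :- s)) refl ½ s t) (cong (½ *_) e))))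
        (riemann-compare n (c * ½) {λ t → F (½ + ½ * t)} {λ t → f (½ + ½ * t)} λ {s} {t} is it e →
          subst (λ z → (z * f (½ + ½ * s)) ~ (F (½ + ½ * t) - F (½ + ½ * s)))
            (solve 4 (λ c k s t → c :* ((k :+ k :* t) :- (k :+ k :* s)) := c :* k :* (t :- s)) refl c ½ s t)
            (h (right-half is) (right-half it)
              (trans (solve 3 (λ k s t → (k :+ k :* t) :- (k :+ k :* s) := k :* (t :- s)) refl ½ s t) (cong (½ *_) e)))))

  mul-inv : ∀ {a b x} → 0ℚ < x → x * a ≤ b → a ≤ b * inv x
  mul-inv {a} {b} {x} 0<x h = subst (_≤ b * inv x)
    (trans (solve 3 (λ x a i → x :* a :* i := a :* (x :* i)) refl x a (inv x)) (trans (cong (a *_) (p*inv 0<x)) (*-identityʳ a)))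
    (*-monoʳ-≤-nonNeg (inv x) {{nonNegative (<⇒≤ (0<inv 0<x))}} h)

  module _ {q : ℚ} (1≤q : 1ℚ ≤ q) where

    -- The substitution that carries [0 , 1] to [1 , q] and turns the integrand into 1/s.
    point : ℚ → ℚ
    point t = 1ℚ + t * (q - 1ℚ)

    1≤point : ∀ {t} → In01 t → 1ℚ ≤ point t
    1≤point i = denominator≥ ≤-refl 1≤q i

    point≤ : ∀ {t} → In01 t → point t ≤ q
    point≤ {t} (_ , t≤1) = ≤-by (0≤* (0≤- t≤1) (0≤- 1≤q))
      (solve 2 (λ q t → (con 1ℚ :- t) :* (q :- con 1ℚ) := q :- (con 1ℚ :+ t :* (q :- con 1ℚ))) refl q t)

    point-diff : ∀ s t → point t - point s ≡ (t - s) * (q - 1ℚ)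
    point-diff s t = solve 4 (λ e d s t → (e :+ t :* d) :- (e :+ s :* d) := (t :- s) :* d) refl 1ℚ (q - 1ℚ) s t

    point-1 : point 1ℚ ≡ q
    point-1 = solve 1 (λ q → con 1ℚ :+ con 1ℚ :* (q :- con 1ℚ) := q) refl q

    point-0 : point 0ℚ ≡ 1ℚ
    point-0 = solve 1 (λ q → con 1ℚ :+ con 0ℚ :* (q :- con 1ℚ) := con 1ℚ) refl q

    Λ-increment : ∀ ℓ → Λ ℓ (point 1ℚ) - Λ ℓ (point 0ℚ) ≡ Λ ℓ q
    Λ-increment ℓ = trans (cong₂ (λ a b → Λ ℓ a - Λ ℓ b) point-1 point-0)
      (trans (cong (λ z → Λ ℓ q - z) (Λ-1 ℓ)) (+-identityʳ (Λ ℓ q)))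

    -- `Λ-concave` refers to the left end of a cell, just as the left Riemann sum does, so the bound
    -- holds for every mesh.
    riemann-lower : ∀ k ℓ → Λ ℓ q ≤ 2ℚ * riemann k (integrand q)
    riemann-lower k ℓ = subst (_≤ 2ℚ * riemann k (integrand q)) (Λ-increment ℓ)
      (riemann-compare {flip _≤_} +-mono-≤ k 2ℚ {λ t → Λ ℓ (point t)} λ {s} {t} is it e →
        subst (Λ ℓ (point t) - Λ ℓ (point s) ≤_)
          (trans (cong (λ z → 2ℚ * z * inv (point s)) (point-diff s t))
            (solve 4 (λ c d m i → c :* (d :* m) :* i := c :* d :* (m :* i)) refl 2ℚ (t - s) (q - 1ℚ) (inv (point s))))
          (mul-inv (<-≤-trans 0<1 (1≤point is)) (Λ-concave ℓ (1≤point is) (s≤t is it e))))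
      where
      s≤t : ∀ {s t} → In01 s → In01 t → t - s ≡ half^ k → point s ≤ point t
      s≤t {s} {t} is it e = ≤-by (0≤* (subst (0ℚ ≤_) (sym e) (<⇒≤ (0<half^ k))) (0≤- 1≤q)) (sym (point-diff s t))

    -- `Λ-steep` refers to the right end of a cell. The mesh condition makes the right end at most
    -- twice the left end, at the cost of the factor 2.
    riemann-upper : ∀ k ℓ → q ≤ nat (2 ℕ.^ ℓ) → half^ k * (q - 1ℚ) ≤ 1ℚ → riemann k (integrand q) ≤ 2ℚ * nat ℓ
    riemann-upper k ℓ q≤ mesh = ≤-trans (subst (_≤ 2ℚ * Λ ℓ (point 1ℚ) - 2ℚ * Λ ℓ (point 0ℚ)) (*-identityˡ _)
      (riemann-compare {_≤_} +-mono-≤ k 1ℚ {λ t → 2ℚ * Λ ℓ (point t)} λ {s} {t} is it e → begin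
        1ℚ * (t - s) * ((q - 1ℚ) * inv (point s))
          ≡⟨ trans (solve 4 (λ u d m i → u :* d :* (m :* i) := u :* (d :* m :* i)) refl 1ℚ (t - s) (q - 1ℚ) (inv (point s))) (*-identityˡ _) ⟩
        (t - s) * (q - 1ℚ) * inv (point s)
          ≤⟨ *-monoˡ-≤-nonNeg ((t - s) * (q - 1ℚ)) {{nonNegative (0≤d {s} {t} e)}} (invs is it e) ⟩
        (t - s) * (q - 1ℚ) * (2ℚ * inv (point t))
          ≡⟨ cong (_* (2ℚ * inv (point t))) (sym (point-diff s t)) ⟩
        (point t - point s) * (2ℚ * inv (point t))
          ≤⟨ *-monoʳ-≤-nonNeg (2ℚ * inv (point t)) {{nonNegative (0≤* {2ℚ} (from-yes (0ℚ ≤? 2ℚ)) (<⇒≤ (0<inv (0<point it))))}}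
               (Λ-steep ℓ (1≤point is) (s≤t {s} {t} e) (≤-trans (point≤ it) q≤)) ⟩
        point t * (Λ ℓ (point t) - Λ ℓ (point s)) * (2ℚ * inv (point t))
          ≡⟨ solve 5 (λ x a b c i → x :* (a :- b) :* (c :* i) := (x :* i) :* (c :* a :- c :* b)) refl
               (point t) (Λ ℓ (point t)) (Λ ℓ (point s)) 2ℚ (inv (point t)) ⟩
        point t * inv (point t) * (2ℚ * Λ ℓ (point t) - 2ℚ * Λ ℓ (point s))
          ≡⟨ trans (cong (_* (2ℚ * Λ ℓ (point t) - 2ℚ * Λ ℓ (point s))) (p*inv (0<point it))) (*-identityˡ _) ⟩
        2ℚ * Λ ℓ (point t) - 2ℚ * Λ ℓ (point s) ∎))
      (≤-trans (≤-reflexive (trans (solve 3 (λ c a b → c :* a :- c :* b := c :* (a :- b)) refl 2ℚ (Λ ℓ (point 1ℚ)) (Λ ℓ (point 0ℚ)))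
         (cong (2ℚ *_) (Λ-increment ℓ)))) (*-monoˡ-≤-nonNeg 2ℚ (Λ≤ ℓ q)))
      where
      open ≤-Reasoning
      0<point : ∀ {t} → In01 t → 0ℚ < point t
      0<point it = <-≤-trans 0<1 (1≤point it)
      0≤d : ∀ {s t} → t - s ≡ half^ k → 0ℚ ≤ (t - s) * (q - 1ℚ)
      0≤d e = 0≤* (subst (0ℚ ≤_) (sym e) (<⇒≤ (0<half^ k))) (0≤- 1≤q)
      s≤t : ∀ {s t} → t - s ≡ half^ k → point s ≤ point t
      s≤t {s} {t} e = ≤-by (0≤d {s} {t} e) (sym (point-diff s t))
      t≤2s : ∀ {s t} → In01 s → t - s ≡ half^ k → point t ≤ 2ℚ * point s
      t≤2s {s} {t} is e = ≤-by
        (0≤+ (0≤- (1≤point is)) (0≤- (subst (_≤ 1ℚ) (trans (cong (_* (q - 1ℚ)) (sym e)) (sym (point-diff s t))) mesh)))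
        (solve 2 (λ a b → (a :- con 1ℚ) :+ (con 1ℚ :- (b :- a)) := con 2ℚ :* a :- b) refl (point s) (point t))
      invs : ∀ {s t} → In01 s → In01 t → t - s ≡ half^ k → inv (point s) ≤ 2ℚ * inv (point t)
      invs {s} {t} is it e = begin
        inv (point s)
          ≤⟨ mul-inv (0<point it) (*-monoʳ-≤-nonNeg (inv (point s)) {{nonNegative (<⇒≤ (0<inv (0<point is)))}} (t≤2s {s} {t} is e)) ⟩
        2ℚ * point s * inv (point s) * inv (point t)
          ≡⟨ cong (_* inv (point t)) (trans (*-assoc 2ℚ (point s) (inv (point s))) (trans (cong (2ℚ *_) (p*inv (0<point is))) (*-identityʳ 2ℚ))) ⟩
        2ℚ * inv (point t) ∎

  ≤-limit : ∀ {p q} → (∀ δ → 0ℚ < δ → p ≤ q + δ) → p ≤ q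
  ≤-limit {p} {q} h with p ≤? q
  ... | yes p≤q = p≤q
  ... | no p≰q  = contradiction (h δ 0<δ) (<⇒≱ (subst (q + δ <_)
      (trans (cong (q +_) (½+½ (p - q))) (solve 2 (λ p q → q :+ (p :- q) := p) refl p q))
      (+-monoʳ-< q (subst (_< δ + δ) (+-identityʳ δ) (+-monoʳ-< δ 0<δ)))))
    where
    δ : ℚ
    δ = ½ * (p - q)
    0<δ : 0ℚ < δ
    0<δ = 0<* (from-yes (0ℚ <? ½)) (subst (_< p - q) (+-inverseʳ q) (+-monoˡ-< (- q) (≰⇒> p≰q)))

  -- Rational approximation of ε and the constants

  _/15 : ℚ → ℚ
  d /15 = (ℤ.+ 1 / 15) * d

  -- Knowing ε up to a factor of 8/7 leaves enough room for K ≤ C with the constant 80.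
  approximate : ∀ ε → 0ℝ <ℝ ε → ∃[ y ] (0ℚ < y × ∃[ N ] (∀ n → N ℕ.≤ n → y ≤ seq ε n × nat 7 * seq ε n ≤ nat 8 * y))
  approximate ε 0<ε with eventually≥ ε 0<ε
  ... | d , 0<d , N₁ , d≤ with cauchy ε (d /15) (0<* (from-yes (0ℚ <? ℤ.+ 1 / 15)) 0<d)
  -- All later terms e lie within d/15 of x ≥ d. Hence y = x - d/15 is at most e, and 7 e ≤ 7 (x +
  -- d/15) ≤ 8 y, the last step being x ≥ d.
  ...   | N₂ , close = x - d /15 , 0<y , N , λ n N≤n → below n N≤n , above n N≤n
    where
    N : ℕ
    N = N₁ ℕ.⊔ N₂
    x : ℚ
    x = seq ε N
    d≤x : d ≤ x
    d≤x = d≤ N (ℕ.m≤m⊔n N₁ N₂)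
    near : ∀ n → N ℕ.≤ n → ∀ {a} → a ≤ ∣ x - seq ε n ∣ → a ≤ d /15
    near n N≤n h = ≤-trans h (close N n (ℕ.m≤n⊔m N₁ N₂) (ℕ.m⊔n≤o⇒n≤o N₁ N₂ N≤n))
    0<y : 0ℚ < x - d /15
    0<y = <-≤-trans (0<* {ℤ.+ 14 / 15} (from-yes (0ℚ <? ℤ.+ 14 / 15)) 0<d) (≤-by (0≤- d≤x)
      (solve 2 (λ x d → x :- d := (x :- con (ℤ.+ 1 / 15) :* d) :- con (ℤ.+ 14 / 15) :* d) refl x d))
    below : ∀ n → N ℕ.≤ n → x - d /15 ≤ seq ε n
    below n N≤n = ≤-by (0≤- (near n N≤n (p≤∣p∣ (x - seq ε n))))
      (solve 3 (λ x e c → c :- (x :- e) := e :- (x :- c)) refl x (seq ε n) (d /15))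
    above : ∀ n → N ℕ.≤ n → nat 7 * seq ε n ≤ nat 8 * (x - d /15)
    above n N≤n = ≤-by (0≤+ (0≤- d≤x) (0≤* {nat 7} (0≤nat 7) (0≤- (near n N≤n
        (subst (seq ε n - x ≤_) (∣p-q∣-sym (seq ε n) x) (p≤∣p∣ (seq ε n - x)))))))
      (solve 3 (λ x e d → (x :- d) :+ con (nat 7) :* (con (ℤ.+ 1 / 15) :* d :- (e :- x))
                       := con (nat 8) :* (x :- con (ℤ.+ 1 / 15) :* d) :- con (nat 7) :* e) refl x (seq ε n) d)

  -- A downward search for 1/y rounded up, stopped at 2 because `Parameters` requires D - 1 to be
  -- nonzero. If it stops there, the upper bound rests on 2 y ≤ 1.
  reciprocal-ceiling : ∀ {y} → 0ℚ < y → ∃[ D ] (1ℚ ≤ nat (2 ℕ.+ D) * y × (2ℚ * y ≤ 1ℚ → nat (2 ℕ.+ D) * y ≤ 1ℚ + y))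
  reciprocal-ceiling {y} 0<y = search (proj₁ arch) (≤-trans (≤-reflexive (sym (trans (*-comm (inv y) y) (p*inv 0<y))))
      (*-monoʳ-≤-nonNeg y {{nonNegative (<⇒≤ 0<y)}} (≤-trans (proj₂ arch) (nat-mono (ℕ.m≤n+m (proj₁ arch) 2)))))
    where
    arch : ∃[ n ] inv y ≤ nat n
    arch = archimedean (inv y)
    search : ∀ D → 1ℚ ≤ nat (2 ℕ.+ D) * y → ∃[ D ] (1ℚ ≤ nat (2 ℕ.+ D) * y × (2ℚ * y ≤ 1ℚ → nat (2 ℕ.+ D) * y ≤ 1ℚ + y))
    search zero    h = 0 , h , λ 2y≤1 → ≤-trans 2y≤1 (≤-trans (≤-reflexive (sym (+-identityʳ 1ℚ))) (+-monoʳ-≤ 1ℚ (<⇒≤ 0<y)))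
    search (suc D) h with 1ℚ ≤? nat (2 ℕ.+ D) * y
    ... | yes h′ = search D h′
    ... | no ¬h  = suc D , h , λ _ → ≤-by (0≤- (<⇒≤ (≰⇒> ¬h)))
      (solve 2 (λ n y → con 1ℚ :- n :* y := con 1ℚ :+ y :- (con 1ℚ :+ n) :* y) refl (nat (2 ℕ.+ D)) y)

  -- A rounded logarithm of D. The upper bound on D serves `2KD<2^j`; the lower bound keeps p, and
  -- with it K, small compared to log (1/ε).
  binary-scale : ∀ D → ∃[ p ] (D ℕ.≤ 2 ℕ.^ (p ℕ.+ 3) × (p ≡ 0 ⊎ 2 ℕ.^ (p ℕ.+ 2) ℕ.≤ D))
  binary-scale zero    = 0 , ℕ.z≤n , inj₁ refl
  binary-scale (suc D) with binary-scale D
  ... | p , D≤ , low with suc D ℕ.≤? 2 ℕ.^ (p ℕ.+ 3)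
  ...   | yes h = p , h , Sum.map₂ ℕ.m≤n⇒m≤1+n low
  ...   | no ¬h = suc p , ≤2^ , inj₂ (ℕ.≤-trans (ℕ.≤-reflexive (cong (2 ℕ.^_) (sym (ℕ.+-suc p 2)))) (ℕ.<⇒≤ (ℕ.≰⇒> ¬h)))
    where
    ≤2^ : suc D ℕ.≤ 2 ℕ.^ (suc p ℕ.+ 3)
    ≤2^ = ℕ.≤-trans (ℕ.+-mono-≤ (ℕ.m^n>0 2 (p ℕ.+ 3)) D≤) (ℕ.≤-reflexive (cong (2 ℕ.^ (p ℕ.+ 3) ℕ.+_) (sym (ℕ.+-identityʳ _))))

  base-exponent : ∀ B n .{{_ : NonZero n}} → 2 ℕ.≤ B → ∃[ m ] (B ℕ.^ m ℕ.≤ n × n ℕ.< B ℕ.^ suc m)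
  base-exponent B 1             2≤B = 0 , ℕ.≤-refl , ℕ.≤-trans 2≤B (ℕ.≤-reflexive (sym (ℕ.*-identityʳ B)))
  base-exponent B (suc n@(suc _)) 2≤B with base-exponent B n 2≤B
  ... | m , lo , hi with suc n ℕ.<? B ℕ.^ suc m
  ...   | yes h = m , ℕ.m≤n⇒m≤1+n lo , h
  ...   | no ¬h = suc m , ℕ.≮⇒≥ ¬h , ℕ.≤-<-trans hi (subst (B ℕ.^ suc m ℕ.<_) (ℕ.*-comm (B ℕ.^ suc m) B)
    (ℕ.m<m*n (B ℕ.^ suc m) B {{ℕ.>-nonZero (ℕ.≤-trans (ℕ.s≤s ℕ.z≤n) hi)}} 2≤B))

  n≤2^n : ∀ n → n ℕ.≤ 2 ℕ.^ n
  n≤2^n zero    = ℕ.z≤n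
  n≤2^n (suc n) = ℕ.+-mono-≤ (ℕ.m^n>0 2 n) (ℕ.≤-trans (n≤2^n n) (ℕ.≤-reflexive (sym (ℕ.+-identityʳ _))))

  -- The source of α: n < B^(m+1) ≤ 2^(B (m+1)), as B ≤ 2^B, so the sums for log n are eventually at
  -- most 2 B (m+1) ≤ 4 B m.
  log-part-size : ∀ B m n .{{_ : NonZero n}} → 2 ℕ.≤ B → 2 ℕ.≤ m → n ℕ.< B ℕ.^ suc m → ∀ s → m ℕ.≤ s →
    fromℚ (inv (nat (4 ℕ.* B))) *ℝ log (fromℕ n) (fromℕ-pos n) ≤ℝ fromℕ s
  log-part-size B m n 2≤B 2≤m n< s m≤s δ 0<δ = proj₁ small , λ k k≥ → begin
    inv (nat (4 ℕ.* B)) * riemann k (integrand (ℤ.+ n / 1))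
      ≡⟨ cong (λ z → inv (nat (4 ℕ.* B)) * riemann k (integrand z)) (fromℕ≡nat n) ⟩
    inv (nat (4 ℕ.* B)) * riemann k (integrand (nat n))
      ≤⟨ *-monoˡ-≤-nonNeg (inv (nat (4 ℕ.* B))) {{nonNegative (<⇒≤ (0<inv 0<4B))}}
           (riemann-upper 1≤n k (B ℕ.* suc m) (nat-mono n≤) (mesh k (proj₂ small k k≥))) ⟩
    inv (nat (4 ℕ.* B)) * (2ℚ * nat (B ℕ.* suc m))
      ≤⟨ *-monoˡ-≤-nonNeg (inv (nat (4 ℕ.* B))) {{nonNegative (<⇒≤ (0<inv 0<4B))}}
           (≤-trans (≤-reflexive (sym (nat-* 2 (B ℕ.* suc m)))) (nat-mono exponent≤)) ⟩
    inv (nat (4 ℕ.* B)) * nat (4 ℕ.* B ℕ.* m)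
      ≡⟨ trans (cong (inv (nat (4 ℕ.* B)) *_) (nat-* (4 ℕ.* B) m)) (trans (sym (*-assoc (inv (nat (4 ℕ.* B))) (nat (4 ℕ.* B)) (nat m)))
           (trans (cong (_* nat m) (trans (*-comm (inv (nat (4 ℕ.* B))) (nat (4 ℕ.* B))) (p*inv 0<4B))) (*-identityˡ (nat m)))) ⟩
    nat m
      ≤⟨ nat-mono m≤s ⟩
    nat s
      ≡⟨ sym (fromℕ≡nat s) ⟩
    ℤ.+ s / 1
      ≤⟨ subst (_≤ ℤ.+ s / 1 + δ) (+-identityʳ (ℤ.+ s / 1)) (+-monoʳ-≤ (ℤ.+ s / 1) (<⇒≤ 0<δ)) ⟩
    ℤ.+ s / 1 + δ ∎
    where
    open ≤-Reasoning
    1≤n : 1ℚ ≤ nat n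
    1≤n = ≤-trans (≤-reflexive (sym (+-identityʳ 1ℚ))) (nat-mono {1} (ℕ.>-nonZero⁻¹ n))
    small : ∃[ N ] (∀ k → N ℕ.≤ k → half^ k ≤ inv (nat n))
    small = half^-small (inv (nat n)) (0<inv (<-≤-trans 0<1 1≤n))
    mesh : ∀ k → half^ k ≤ inv (nat n) → half^ k * (nat n - 1ℚ) ≤ 1ℚ
    mesh k h = ≤-trans (*-monoˡ-≤-nonNeg (half^ k) {{nonNegative (<⇒≤ (0<half^ k))}}
        (≤-by 0≤1 (solve 1 (λ n → con 1ℚ := n :- (n :- con 1ℚ)) refl (nat n))))
      (≤-trans (*-monoʳ-≤-nonNeg (nat n) {{nonNegative (0≤nat n)}} h)
        (≤-reflexive (trans (*-comm (inv (nat n)) (nat n)) (p*inv (<-≤-trans 0<1 1≤n)))))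
    0<4B : 0ℚ < nat (4 ℕ.* B)
    0<4B = <-≤-trans (from-yes (0ℚ <? nat 1)) (nat-mono {1} (ℕ.*-mono-≤ {1} {4} {1} (ℕ.s≤s ℕ.z≤n) (ℕ.≤-trans (ℕ.s≤s ℕ.z≤n) 2≤B)))
    n≤ : n ℕ.≤ 2 ℕ.^ (B ℕ.* suc m)
    n≤ = ℕ.≤-trans (ℕ.<⇒≤ n<) (ℕ.≤-trans (ℕ.^-monoˡ-≤ (suc m) (n≤2^n B)) (ℕ.≤-reflexive (ℕ.^-*-assoc 2 B (suc m))))
    exponent≤ : 2 ℕ.* (B ℕ.* suc m) ℕ.≤ 4 ℕ.* B ℕ.* m
    exponent≤ = ℕ.≤-trans (ℕ.*-monoʳ-≤ 2 (ℕ.*-monoʳ-≤ B {suc m} {2 ℕ.* m} (ℕ.≤-trans (ℕ.+-monoˡ-≤ m (ℕ.≤-trans (ℕ.s≤s ℕ.z≤n) 2≤m))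
        (ℕ.≤-reflexive (cong (m ℕ.+_) (sym (ℕ.+-identityʳ m)))))))
      (ℕ.≤-reflexive (ℕS.solve 2 (λ B m → ℕS.con 2 ℕS.:* (B ℕS.:* (ℕS.con 2 ℕS.:* m)) ℕS.:= ℕS.con 4 ℕS.:* B ℕS.:* m) refl B m))
      where module ℕS = ℕSolver.+-*-Solver

  -- The constant 80 is 20 · 2 · 2: K ≤ D (3p + 14) ≤ 20 D (p + 3/4), where D ≤ 2/e and p + 3/4 ≤
  -- `Λ (suc p) (inv e)` ≤ 2 R.
  vertex-count : ∀ {K D p y e R} → 0ℚ < e → y ≤ e → nat 7 * e ≤ nat 8 * y → 2ℚ * y ≤ 1ℚ → nat D * y ≤ 1ℚ + y →
    p ≡ 0 ⊎ 2 ℕ.^ (p ℕ.+ 2) ℕ.≤ D → K ℕ.≤ D ℕ.* (3 ℕ.* p ℕ.+ 14) →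
    (1ℚ ≤ inv e → Λ (suc p) (inv e) ≤ 2ℚ * R) → nat K ≤ nat 80 * inv e * R
  vertex-count {K} {D} {p} {y} {e} {R} 0<e y≤e 7e≤ 2y≤1 Dy≤ scale K≤ lower = begin
    nat K
      ≤⟨ ≤-trans (nat-mono K≤) (≤-reflexive (trans (nat-* D (3 ℕ.* p ℕ.+ 14)) (cong (nat D *_) (trans (nat-+ (3 ℕ.* p) 14) (cong (_+ nat 14) (nat-* 3 p)))))) ⟩
    nat D * (nat 3 * nat p + nat 14)
      ≤⟨ *-monoˡ-≤-nonNeg (nat D) {{nonNegative (0≤nat D)}} (≤-by (0≤+ (0≤* {nat 17} (0≤nat 17) (0≤nat p)) 0≤1)
           (solve 1 (λ p → con (nat 17) :* p :+ con 1ℚ := con (nat 20) :* (p :+ con ¾) :- (con (nat 3) :* p :+ con (nat 14))) refl (nat p))) ⟩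
    nat D * (nat 20 * (nat p + ¾))
      ≤⟨ *-mono {nat D} {2ℚ * inv e} (0≤* {nat 20} (0≤nat 20) (0≤+ (0≤nat p) (from-yes (0ℚ ≤? ¾)))) (0≤* {2ℚ} (from-yes (0ℚ ≤? 2ℚ)) (<⇒≤ (0<inv 0<e)))
           D≤2/e (*-monoˡ-≤-nonNeg (nat 20) (≤-trans (Λ-large p large) (lower 1≤1/e))) ⟩
    2ℚ * inv e * (nat 20 * (2ℚ * R))
      ≡⟨ solve 2 (λ i R → con 2ℚ :* i :* (con (nat 20) :* (con 2ℚ :* R)) := con (nat 80) :* i :* R) refl (inv e) R ⟩
    nat 80 * inv e * R ∎
    where
    open ≤-Reasoning
    14D≤ : nat 7 * (e * nat D) ≤ nat 7 * 2ℚ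
    14D≤ = begin
      nat 7 * (e * nat D)      ≡⟨ sym (*-assoc (nat 7) e (nat D)) ⟩
      nat 7 * e * nat D        ≤⟨ *-monoʳ-≤-nonNeg (nat D) {{nonNegative (0≤nat D)}} 7e≤ ⟩
      nat 8 * y * nat D        ≡⟨ solve 3 (λ c y d → c :* y :* d := c :* (d :* y)) refl (nat 8) y (nat D) ⟩
      nat 8 * (nat D * y)      ≤⟨ *-monoˡ-≤-nonNeg (nat 8) Dy≤ ⟩
      nat 8 * (1ℚ + y)         ≤⟨ ≤-by (0≤+ (0≤* {nat 4} (0≤nat 4) (0≤- 2y≤1)) (0≤nat 2))
                                    (solve 1 (λ y → con (nat 4) :* (con 1ℚ :- con 2ℚ :* y) :+ con (nat 2) := con (nat 7) :* con 2ℚ :- con (nat 8) :* (con 1ℚ :+ y)) refl y) ⟩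
      nat 7 * 2ℚ ∎
    D≤2/e : nat D ≤ 2ℚ * inv e
    D≤2/e = mul-inv 0<e (*-cancelˡ-≤-pos (nat 7) 14D≤)
    -- For p = 0 the accuracy 8/7 is just enough: 7 e ≤ 8 y ≤ 4. Otherwise 1/e ≥ D/2 ≥ 2^(p+1).
    large : (1ℚ + ¾) * nat (2 ℕ.^ p) ≤ inv e
    large = case scale
      where
      case : p ≡ 0 ⊎ 2 ℕ.^ (p ℕ.+ 2) ℕ.≤ D → (1ℚ + ¾) * nat (2 ℕ.^ p) ≤ inv e
      case (inj₁ refl) = ≤-trans (mul-inv {b = 1ℚ} 0<e (≤-by (0≤+ (0≤* {ℤ.+ 1 / 4} (from-yes (0ℚ ≤? ℤ.+ 1 / 4)) (0≤- 7e≤)) (0≤- 2y≤1))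
        (solve 2 (λ e y → con (ℤ.+ 1 / 4) :* (con (nat 8) :* y :- con (nat 7) :* e) :+ (con 1ℚ :- con 2ℚ :* y)
                       := con 1ℚ :- e :* con ((1ℚ + ¾) * nat 1)) refl e y))) (≤-reflexive (*-identityˡ (inv e)))
      case (inj₂ 2^≤D) = *-cancelˡ-≤-pos 2ℚ (begin
        2ℚ * ((1ℚ + ¾) * nat (2 ℕ.^ p))   ≤⟨ ≤-by (0≤* {½} {nat (2 ℕ.^ p)} 0≤½ (0≤nat (2 ℕ.^ p)))
                                              (solve 1 (λ n → con ½ :* n := n :* con (nat 4) :- con 2ℚ :* (con (1ℚ + ¾) :* n)) refl (nat (2 ℕ.^ p))) ⟩
        nat (2 ℕ.^ p) * nat 4            ≡⟨ trans (sym (nat-* (2 ℕ.^ p) 4)) (cong nat (sym (ℕ.^-distribˡ-+-* 2 p 2))) ⟩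
        nat (2 ℕ.^ (p ℕ.+ 2))            ≤⟨ nat-mono 2^≤D ⟩
        nat D                            ≤⟨ D≤2/e ⟩
        2ℚ * inv e ∎)
    1≤1/e : 1ℚ ≤ inv e
    1≤1/e = ≤-trans (from-yes (1ℚ ≤? (1ℚ + ¾) * nat 1)) (≤-trans (*-monoˡ-≤-nonNeg (1ℚ + ¾) (nat-mono (ℕ.m^n>0 2 p))) large)

  -- Assembly of the combinatorial and analytic parts

  fromℚ-pos : ∀ {q} → 0ℚ < q → 0ℝ <ℝ fromℚ q
  fromℚ-pos {q} 0<q = q , 0<q , 0 , λ _ _ → ≤-reflexive (+-identityˡ q)

  degree≥ : ∀ {r n y N} ε (G : ColouredGraph r n) → (∀ k → N ℕ.≤ k → y ≤ seq ε k) → LocallyBalanced G ε →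
    ∀ v c → y * nat n ≤ nat (degree G c v)
  degree≥ {n = n} {y} {N} ε G y≤ balanced v c = ≤-limit λ δ 0<δ →
    let N′ , h = balanced v c δ 0<δ
        k = N ℕ.⊔ N′
    in begin
      y * nat n                         ≤⟨ *-monoʳ-≤-nonNeg (nat n) {{nonNegative (0≤nat n)}} (y≤ k (ℕ.m≤m⊔n N N′)) ⟩
      seq ε k * nat n                   ≡⟨ cong (seq ε k *_) (sym (fromℕ≡nat n)) ⟩
      seq ε k * (ℤ.+ n / 1)             ≤⟨ h k (ℕ.m≤n⊔m N N′) ⟩
      ℤ.+ degree G c v / 1 + δ          ≡⟨ cong (_+ δ) (fromℕ≡nat (degree G c v)) ⟩
      nat (degree G c v) + δ ∎
    where open ≤-Reasoning

  -- The interface to the combinatorial part: the value of the base is hidden, and the real part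
  -- size t enters only through a comparison with cardinalities.
  Admissible : ℕ → ℕ → ℕ → Set
  Admissible D K r = ∃[ b ] (2 ℕ.≤ b ×
    (∀ {n} (G : ColouredGraph (suc r) n) → Complete G → .{{_ : NonZero n}} → suc r ℕ.≤ D →
      (∀ u c → n ℕ.≤ D ℕ.* degree G c u) → ∀ m {t} → 2 ℕ.≤ m → b ℕ.^ m ℕ.≤ n →
      (∀ (S : Subset n) → m ℕ.≤ Subset.∣ S ∣ → t ≤ℝ fromℕ Subset.∣ S ∣) →
      Σ[ H ∈ ColouredGraph (suc r) K ] (Unibalanced H × HomogeneousBlowUp t H G)))

  blow-up-base : ∀ D′ p .{{_ : NonZero D′}} (D≤ : suc D′ ℕ.≤ 2 ℕ.^ (p ℕ.+ 3)) r →
    Admissible (suc D′) (Parameters.K D′ p D≤) r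
  blow-up-base D′ p D≤ r = base r , 2≤base r , λ G complete → blow-up-exists r G complete
    where open Parameters D′ p D≤

  module Balanced {ε : ℝ} {y : ℚ} {N : ℕ} (0<y : 0ℚ < y) (near : ∀ k → N ℕ.≤ k → y ≤ seq ε k × nat 7 * seq ε k ≤ nat 8 * y)
    {D : ℕ} (1≤Dy : 1ℚ ≤ nat D * y) {r n : ℕ} .{{_ : NonZero n}} (G : ColouredGraph (suc (suc r)) n) (balanced : LocallyBalanced G ε) where

    y-degree : ∀ v c → y * nat n ≤ nat (degree G c v)
    y-degree = degree≥ ε G (λ k N≤k → proj₁ (near k N≤k)) balanced

    n≤D*degree : ∀ v c → n ℕ.≤ D ℕ.* degree G c v
    n≤D*degree v c = nat-cancel-≤ (begin
      nat n                        ≡⟨ sym (*-identityˡ (nat n)) ⟩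
      1ℚ * nat n                   ≤⟨ *-monoʳ-≤-nonNeg (nat n) {{nonNegative (0≤nat n)}} 1≤Dy ⟩
      nat D * y * nat n            ≡⟨ *-assoc (nat D) y (nat n) ⟩
      nat D * (y * nat n)          ≤⟨ *-monoˡ-≤-nonNeg (nat D) {{nonNegative (0≤nat D)}} (y-degree v c) ⟩
      nat D * nat (degree G c v)   ≡⟨ sym (nat-* D (degree G c v)) ⟩
      nat (D ℕ.* degree G c v) ∎)
      where open ≤-Reasoning

    v₀ : Fin n
    v₀ = fromℕ< (ℕ.>-nonZero⁻¹ n)

    0<n : 0ℚ < nat n
    0<n = <-≤-trans (from-yes (0ℚ <? nat 1)) (nat-mono {1} (ℕ.>-nonZero⁻¹ n))

    -- Two colours at one vertex already use 2 y n of its at most n edges. The bound comes from the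
    -- graph, as ε itself may be large; this is why `Dy≤` is stated conditionally.
    2y≤1 : 2ℚ * y ≤ 1ℚ
    2y≤1 = *-cancelʳ-≤-pos (nat n) {{positive 0<n}} (begin
      2ℚ * y * nat n
        ≡⟨ solve 2 (λ y n → con 2ℚ :* y :* n := y :* n :+ y :* n) refl y (nat n) ⟩
      y * nat n + y * nat n
        ≤⟨ +-mono-≤ (y-degree v₀ zero) (y-degree v₀ (suc zero)) ⟩
      nat (degree G zero v₀) + nat (degree G (suc zero) v₀)
        ≡⟨ sym (nat-+ (degree G zero v₀) (degree G (suc zero) v₀)) ⟩
      nat (degree G zero v₀ ℕ.+ degree G (suc zero) v₀)
        ≤⟨ nat-mono (ℕ.≤-trans (ℕ.+-monoʳ-≤ (degree G zero v₀) (ℕ.m≤m+n _ _)) (Estimator.∑-degree G v₀)) ⟩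
      nat n
        ≡⟨ sym (*-identityˡ (nat n)) ⟩
      1ℚ * nat n ∎)
      where open ≤-Reasoning

    r≤D : suc (suc r) ℕ.≤ D
    r≤D = ℕ.*-cancelʳ-≤ (suc (suc r)) D n (begin
      suc (suc r) ℕ.* n
        ≡⟨ sym (trans (∑-const (allFin (suc (suc r))) n) (cong (ℕ._* n) (length-allFin (suc (suc r))))) ⟩
      ∑ (allFin (suc (suc r))) (λ _ → n)
        ≤⟨ ∑-mono (allFin (suc (suc r))) (n≤D*degree v₀) ⟩
      ∑ (allFin (suc (suc r))) (λ c → D ℕ.* degree G c v₀)
        ≡⟨ ∑-*ˡ (allFin (suc (suc r))) (λ c → degree G c v₀) D ⟩
      D ℕ.* ∑ (allFin (suc (suc r))) (λ c → degree G c v₀)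
        ≤⟨ ℕ.*-monoʳ-≤ D (Estimator.∑-degree G v₀) ⟩
      D ℕ.* n ∎)
      where open ℕ.≤-Reasoning

  few-vertices : ∀ {ε 0<ε y N D p K} → 0ℚ < y → (∀ k → N ℕ.≤ k → y ≤ seq ε k × nat 7 * seq ε k ≤ nat 8 * y) →
    2ℚ * y ≤ 1ℚ → nat D * y ≤ 1ℚ + y → p ≡ 0 ⊎ 2 ℕ.^ (p ℕ.+ 2) ℕ.≤ D → K ℕ.≤ D ℕ.* suc (3 ℕ.* p ℕ.+ 13) →
    fromℕ K ≤ℝ fromℕ 80 *ℝ recip ε 0<ε *ℝ log (recip ε 0<ε) (recip-pos ε 0<ε)
  few-vertices {ε} {0<ε} {y} {N} {D} {p} {K} 0<y near 2y≤1 Dy≤ scale K≤ δ 0<δ = N , λ k N≤k → let e = seq ε k ; R = riemann k (integrand (inv e)) in begin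
    ℤ.+ K / 1
      ≡⟨ fromℕ≡nat K ⟩
    nat K
      ≤⟨ vertex-count {K} {D} {p} (<-≤-trans 0<y (proj₁ (near k N≤k))) (proj₁ (near k N≤k)) (proj₂ (near k N≤k)) 2y≤1 Dy≤ scale
           (subst (λ z → K ℕ.≤ D ℕ.* z) (sym (ℕ.+-suc (3 ℕ.* p) 13)) K≤) (λ 1≤i → riemann-lower 1≤i k (suc p)) ⟩
    nat 80 * inv e * R
      ≡⟨ cong (λ z → z * inv e * R) (sym (fromℕ≡nat 80)) ⟩
    (ℤ.+ 80 / 1) * inv e * R
      ≤⟨ subst (_≤ (ℤ.+ 80 / 1) * inv e * R + δ) (+-identityʳ _) (+-monoʳ-≤ ((ℤ.+ 80 / 1) * inv e * R) (<⇒≤ 0<δ)) ⟩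
    (ℤ.+ 80 / 1) * inv e * R + δ ∎
    where open ≤-Reasoning

  BlowUps : (ε : ℝ) → 0ℝ <ℝ ε → ℕ → Set
  BlowUps ε 0<ε r = let C = fromℕ 80 *ℝ recip ε 0<ε *ℝ log (recip ε 0<ε) (recip-pos ε 0<ε) in
    Σ[ α ∈ ℝ ] (0ℝ <ℝ α × (∃[ N ] (∀ (n : ℕ) .{{_ : NonZero n}} → N ℕ.≤ n →
      (G : ColouredGraph r n) → Complete G → LocallyBalanced G ε →
      ∃[ k ] Σ[ H ∈ ColouredGraph r k ]
        (1 ℕ.≤ k × fromℕ k ≤ℝ C × Unibalanced H ×
          HomogeneousBlowUp (α *ℝ log (fromℕ n) (fromℕ-pos n)) H G))))

  module _ {ε : ℝ} {0<ε : 0ℝ <ℝ ε} {y : ℚ} {N : ℕ} (0<y : 0ℚ < y)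
           (near : ∀ k → N ℕ.≤ k → y ≤ seq ε k × nat 7 * seq ε k ≤ nat 8 * y)
           {D K p r : ℕ} (1≤Dy : 1ℚ ≤ nat D * y) (Dy≤ : 2ℚ * y ≤ 1ℚ → nat D * y ≤ 1ℚ + y)
           (scale : p ≡ 0 ⊎ 2 ℕ.^ (p ℕ.+ 2) ℕ.≤ D) (K≤ : suc K ℕ.≤ D ℕ.* suc (3 ℕ.* p ℕ.+ 13)) where

    blow-ups : Admissible D (suc K) (suc r) → BlowUps ε 0<ε (suc (suc r))
    -- α = 1/(4 b) is the constant of `log-part-size`; n ≥ b² makes the exponent m at least 2, which
    -- gives the two rows that the blow-up requires.
    blow-ups (b , 2≤b , blow-up) = fromℚ (inv (nat (4 ℕ.* b))) , fromℚ-pos (0<inv 0<4b) , b ℕ.^ 2 , result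
      where
      0<4b : 0ℚ < nat (4 ℕ.* b)
      0<4b = <-≤-trans (from-yes (0ℚ <? nat 1)) (nat-mono {1} (ℕ.*-mono-≤ {1} {4} {1} (ℕ.s≤s ℕ.z≤n) (ℕ.≤-trans (ℕ.s≤s ℕ.z≤n) 2≤b)))
      result : ∀ (n : ℕ) .{{_ : NonZero n}} → b ℕ.^ 2 ℕ.≤ n →
        (G : ColouredGraph (suc (suc r)) n) → Complete G → LocallyBalanced G ε →
        ∃[ k ] Σ[ H ∈ ColouredGraph (suc (suc r)) k ]
          (1 ℕ.≤ k × fromℕ k ≤ℝ fromℕ 80 *ℝ recip ε 0<ε *ℝ log (recip ε 0<ε) (recip-pos ε 0<ε) × Unibalanced H ×
            HomogeneousBlowUp (fromℚ (inv (nat (4 ℕ.* b))) *ℝ log (fromℕ n) (fromℕ-pos n)) H G)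
      result n b²≤n G complete balanced = go (base-exponent b n 2≤b)
        where
        open Balanced {ε} {y} {N} 0<y near {D} 1≤Dy G balanced
        go : ∃[ m ] (b ℕ.^ m ℕ.≤ n × n ℕ.< b ℕ.^ suc m) → _
        go (m , b^m≤n , n<) =
          let H , unibalanced , parts = blow-up G complete r≤D n≤D*degree m 2≤m b^m≤n
                (λ S m≤ → log-part-size b m n 2≤b 2≤m n< Subset.∣ S ∣ m≤)
          in suc K , H , ℕ.s≤s ℕ.z≤n , few-vertices {ε} {0<ε} {y} {N} {D} {p} {suc K} 0<y near 2y≤1 (Dy≤ 2y≤1) scale K≤ , unibalanced , parts
          where
          2≤m : 2 ℕ.≤ m
          2≤m = ℕ.≮⇒≥ λ m<2 → ℕ.<⇒≱ (ℕ.<-≤-trans n< (ℕ.^-monoʳ-≤ b {{ℕ.>-nonZero (ℕ.≤-trans (ℕ.s≤s ℕ.z≤n) 2≤b)}} m<2)) b²≤n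

  locally-balanced⇒blow-ups : ∀ ε 0<ε r → 2 ℕ.≤ r → BlowUps ε 0<ε r
  locally-balanced⇒blow-ups ε 0<ε (suc zero)    (ℕ.s≤s ())
  locally-balanced⇒blow-ups ε 0<ε (suc (suc r)) _ = approximated (approximate ε 0<ε)
    where
    approximated : ∃[ y ] (0ℚ < y × ∃[ N ] (∀ n → N ℕ.≤ n → y ≤ seq ε n × nat 7 * seq ε n ≤ nat 8 * y)) → BlowUps ε 0<ε (suc (suc r))
    approximated (y , 0<y , N , near) = scaled (reciprocal-ceiling 0<y)
      where
      scaled : ∃[ D ] (1ℚ ≤ nat (2 ℕ.+ D) * y × (2ℚ * y ≤ 1ℚ → nat (2 ℕ.+ D) * y ≤ 1ℚ + y)) → BlowUps ε 0<ε (suc (suc r))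
      scaled (D , 1≤Dy , Dy≤) =
        let p , D≤ , scale = binary-scale (2 ℕ.+ D)
        in blow-ups {ε} {0<ε} {y} {N} 0<y near {2 ℕ.+ D} {Parameters.k (suc D) p D≤} {p} {r} 1≤Dy Dy≤ scale
             (Parameters.K≤ (suc D) p D≤) (blow-up-base (suc D) p D≤ (suc r))

open import Data.Nat using (_≤_)

theorem4p3 : (ε : ℝ) (0<ε : 0ℝ <ℝ ε) (r : ℕ) → 2 ≤ r →
    let C = fromℕ 80 *ℝ recip ε 0<ε *ℝ log (recip ε 0<ε) (recip-pos ε 0<ε) in
    Σ[ α ∈ ℝ ] (0ℝ <ℝ α × (∃[ N ] (∀ (n : ℕ) .{{_ : NonZero n}} → N ≤ n →
    (G : ColouredGraph r n) → Complete G → LocallyBalanced G ε →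
    ∃[ k ] Σ[ H ∈ ColouredGraph r k ]
    (1 ≤ k × fromℕ k ≤ℝ C × Unibalanced H ×
    HomogeneousBlowUp (α *ℝ log (fromℕ n) (fromℕ-pos n)) H G))))
theorem4p3 = Analysis.locally-balanced⇒blow-ups
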